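{- The functors $\alpha:\mathbf{sHF}\to\mathbf{sN}$ and $\beta:\mathbf{sN}\to\mathbf{sHF}$ establish an equivalence between the categories $\mathbf{sHF}$ and $\mathbf{sN}$; that is, $\beta\alpha$ is naturally isomorphic to the identity functor of $\mathbf{sHF}$ and $\alpha\beta$ is naturally isomorphic to the identity functor of $\mathbf{sN}$.
   Context: **Semi-Heyting algebra**: an algebra $\mathbf{H}=\langle H;\land,\lor,\Rightarrow,0,1\rangle$ of type $(2,2,2,0,0)$ such that $\langle H,\land,\lor,0,1\rangle$ is a bounded lattice and for all $x,y,z\in H$: $x\land(x\Rightarrow y)=x\land y$; $x\land(y\Rightarrow z)=x\land((x\land y)\Rightarrow(x\land z))$; $x\Rightarrow x=1$. Write $x^*=x\Rightarrow 0$ (this is the pseudocomplement of $x$). An element $x$ is dense if $x^*=0$; $\mathcal{D}_s(H)$ is the set of dense elements of $H$. **Semi-Nelson algebra**: an algebra $\mathbf{A}=\langle A;\land,\lor,\to,\sim,1\rangle$ of type $(2,2,2,1,0)$ such that, writing $x\to_N y:=x\to(x\land y)$, for all $x,y,z\in A$: (SN1) $x\land(x\lor y)=x$; (SN2) $x\land(y\lor z)=(z\land x)\lor(y\land x)$; (SN3) $\sim\sim x=x$; (SN4) $\sim(x\land y)=\sim x\lor\sim y$; (SN5) $x\land\sim x=(x\land\sim x)\land(y\lor\sim y)$; (SN6) $x\land(x\to_N y)=x\land(\sim x\lor y)$; (SN7) $x\to_N(y\to_N z)=(x\land y)\to_N z$; (SN8) $(x\to_N y)\to_N[(y\to_N x)\to_N[(x\to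 z)\to_N(y\to z)]]=1$; (SN9) $(x\to_N y)\to_N[(y\to_N x)\to_N[(z\to x)\to_N(z\to y)]]=1$; (SN10) $(\sim(x\to y))\to_N(x\land\sim y)=1$; (SN11) $(x\land\sim y)\to_N(\sim(x\to y))=1$. **$i$-filter**: a subset $F\subseteq H$ of a semi-Heyting algebra $\mathbf{H}$ such that (IF1) $F$ is a lattice filter of $\mathbf{H}$; (IF2) $\mathcal{D}_s(H)\subseteq F$; (IF3) whenever $z,t\in H$ and $z\lor t\in F$, then for all $x\in H$, $(x\Rightarrow z)\lor(x\land t)\in F$. **The algebra $\mathbf{N(H,F)}$**: for a semi-Heyting algebra $\mathbf{H}$ and an $i$-filter $F$, $N(H,F)=\{(a,b)\in H^2: a\land b=0,\ a\lor b\in F\}$, and $\mathbf{N(H,F)}=\langle N(H,F);\sqcap,\sqcup,\to,\sim,\top\rangle$ with $(a,b)\sqcap(c,d)=(a\land c,b\lor d)$, $(a,b)\sqcup(c,d)=(a\lor c,b\land d)$, $(a,b)\to(c,d)=(a\Rightarrow c,a\land d)$, $\sim(a,b)=(b,a)$, $\top=(1,0)$. It is a semi-Nelson algebra. **Quotient $\mathbf{sH}(\mathbf{A})$**: for a semi-Nelson algebra $\mathbf{A}$, put $x\equiv y$ iff $x\to y=1$ and $y\to x=1$. This is an equivalence relation compatible with $\land,\lor,\to$; $[\![x]\!]$ denotes the class of $x$. $\mathbf{sH}(\mathbf{A})=\langle A/_\equiv,\cap,\cup,\Rightarrow,\bot,\top\rangle$ with $\bot=[\![\sim 1]\!]$,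 $\top=[\![1]\!]$, $[\![x]\!]\cap[\![y]\!]=[\![x\land y]\!]$, $[\![x]\!]\cup[\![y]\!]=[\![x\lor y]\!]$, $[\![x]\!]\Rightarrow[\![y]\!]=[\![x\to y]\!]$; it is a semi-Heyting algebra. **Positive elements**: $A^+=\{a\in A:\ \sim a\le a\}$ for a semi-Nelson algebra $\mathbf{A}$, and $[\![A^+]\!]=\{[\![a]\!]:a\in A^+\}$, which is an $i$-filter of $\mathbf{sH}(\mathbf{A})$. **Categories**: $\mathbf{sHF}$ has as objects the pairs $(\mathbf{H},F)$ with $\mathbf{H}$ a semi-Heyting algebra and $F$ an $i$-filter of $\mathbf{H}$; a morphism $f:(\mathbf{H},F)\to(\mathbf{H}',F')$ is a homomorphism of semi-Heyting algebras $f:H\to H'$ with $f(F)\subseteq F'$. $\mathbf{sN}$ is the category of semi-Nelson algebras and their homomorphisms. **Functors**: $\alpha(\mathbf{H},F)=\mathbf{N(H,F)}$ and $\alpha(f)(a,b)=(f(a),f(b))$; $\beta(\mathbf{A})=(\mathbf{sH}(\mathbf{A}),[\![A^+]\!])$ and $\beta(f)([\![a]\!])=[\![f(a)]\!]$. -}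

module Defs where

open import Level using (Level; _⊔_; suc)
open import Data.Product using (_×_; _,_; ∃; proj₁; proj₂)
open import Function.Base using (id; _∘_; _$_)
open import Relation.Binary.Core using (Rel)
open import Relation.Binary.Bundles using (Setoid)
open import Relation.Binary.Structures using (IsEquivalence)
open import Relation.Unary using (Pred; _∈_)
open import Algebra.Core using (Op₁; Op₂)
open import Algebra.Lattice.Bundles using (Lattice)
open import Algebra.Lattice.Structures using (IsLattice)
import Algebra.Definitions as AlgebraDefinitions
import Algebra.Morphism.Definitions as MorphismDefinitions
import Algebra.Lattice.Properties.Lattice as AlgLatticeProperties
import Relation.Binary.Construct.NaturalOrder.Left as NaturalOrder
import Relation.Binary.Lattice as Order
import Relation.Binary.Lattice.Properties.Lattice as LatticeProperties
import Relation.Binary.Lattice.Properties.JoinSemilattice as JoinProperties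
import Relation.Binary.Lattice.Properties.MeetSemilattice as MeetProperties
import Relation.Binary.Lattice.Properties.BoundedJoinSemilattice as BJoinProperties
import Relation.Binary.Lattice.Properties.BoundedMeetSemilattice as BMeetProperties
import Relation.Binary.Lattice.Properties.DistributiveLattice as DistributiveProperties
import Relation.Binary.Lattice.Properties.HeytingAlgebra as HeytingProperties
import Relation.Binary.Reasoning.Setoid as ≈-Reasoning
import Relation.Binary.Reasoning.PartialOrder as ≤-Reasoning

-- Algebras are carried by setoids, so that a quotient algebra is the
-- original carrier with a coarser equality; operations are required to
-- respect the equality, and subsets to be closed under it.
--
-- The records without eta-equality have inlined constructors, so that record
-- expressions defining a structure unfold only under projections; otherwise
-- comparing two structures normalises the proofs of all their laws.

record SemiHeytingAlgebra c ℓ : Set (suc (c ⊔ ℓ)) where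
  no-eta-equality
  constructor mkSemiHeytingAlgebra
  infix  4 _≈_
  infixr 5 _⇒_
  infixr 6 _∨_
  infixr 7 _∧_
  infix  8 _*
  field
    Carrier : Set c
    _≈_     : Rel Carrier ℓ
    _∧_     : Op₂ Carrier
    _∨_     : Op₂ Carrier
    _⇒_     : Op₂ Carrier
    0#      : Carrier
    1#      : Carrier

  open AlgebraDefinitions _≈_ using (Identity; Congruent₂)

  field
    isLattice  : IsLattice _≈_ _∨_ _∧_
    ∨-identity : Identity 0# _∨_
    ∧-identity : Identity 1# _∧_
    ⇒-cong     : Congruent₂ _⇒_
    ∧-⇒        : ∀ x y → x ∧ (x ⇒ y) ≈ x ∧ y
    ∧-⇒-∧      : ∀ x y z → x ∧ (y ⇒ z) ≈ x ∧ (x ∧ y ⇒ x ∧ z)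
    x⇒x≈1      : ∀ x → (x ⇒ x) ≈ 1#

  _* : Op₁ Carrier
  x * = x ⇒ 0#

  Dense : Pred Carrier ℓ
  Dense x = x * ≈ 0#

  open NaturalOrder _≈_ _∧_ public using (_≤_)

  lattice : Lattice c ℓ
  lattice = record { isLattice = isLattice }

  open IsLattice isLattice public
    using (isEquivalence; refl; sym; trans; ∧-cong; ∨-cong)

{-# INLINE mkSemiHeytingAlgebra #-}

record IsLatticeFilter {c ℓ p} (H : SemiHeytingAlgebra c ℓ)
       (F : Pred (SemiHeytingAlgebra.Carrier H) p) : Set (c ⊔ ℓ ⊔ p) where
  no-eta-equality
  open SemiHeytingAlgebra H
  field
    resp     : ∀ {x y} → x ≈ y → x ∈ F → y ∈ F
    nonempty : ∃ λ x → x ∈ F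
    upward   : ∀ {x y} → x ≤ y → x ∈ F → y ∈ F
    ∧-closed : ∀ {x y} → x ∈ F → y ∈ F → x ∧ y ∈ F

record IsIFilter {c ℓ p} (H : SemiHeytingAlgebra c ℓ)
       (F : Pred (SemiHeytingAlgebra.Carrier H) p) : Set (c ⊔ ℓ ⊔ p) where
  no-eta-equality
  open SemiHeytingAlgebra H
  field
    isLatticeFilter : IsLatticeFilter H F
    dense           : ∀ {x} → Dense x → x ∈ F
    ⇒-closed        : ∀ {z t} → z ∨ t ∈ F → ∀ x → (x ⇒ z) ∨ (x ∧ t) ∈ F

  open IsLatticeFilter isLatticeFilter public

record SemiHeytingHomomorphism {c ℓ c′ ℓ′}
       (H : SemiHeytingAlgebra c ℓ) (H′ : SemiHeytingAlgebra c′ ℓ′)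
       : Set (c ⊔ ℓ ⊔ c′ ⊔ ℓ′) where
  no-eta-equality
  constructor mkSemiHeytingHomomorphism
  private
    module H  = SemiHeytingAlgebra H
    module H′ = SemiHeytingAlgebra H′
  open MorphismDefinitions H.Carrier H′.Carrier H′._≈_
  field
    ⟦_⟧    : H.Carrier → H′.Carrier
    cong   : ∀ {x y} → x H.≈ y → ⟦ x ⟧ H′.≈ ⟦ y ⟧
    ∧-homo : Homomorphic₂ ⟦_⟧ H._∧_ H′._∧_
    ∨-homo : Homomorphic₂ ⟦_⟧ H._∨_ H′._∨_
    ⇒-homo : Homomorphic₂ ⟦_⟧ H._⇒_ H′._⇒_
    0-homo : Homomorphic₀ ⟦_⟧ H.0# H′.0#
    1-homo : Homomorphic₀ ⟦_⟧ H.1# H′.1#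

{-# INLINE mkSemiHeytingHomomorphism #-}

record SemiNelsonAlgebra c ℓ : Set (suc (c ⊔ ℓ)) where
  no-eta-equality
  constructor mkSemiNelsonAlgebra
  infix  4 _≈_
  infixr 5 _⇒_ _⇒ₙ_
  infixr 6 _∨_
  infixr 7 _∧_
  infix  8 ∼_
  field
    Carrier : Set c
    _≈_     : Rel Carrier ℓ
    _∧_     : Op₂ Carrier
    _∨_     : Op₂ Carrier
    _⇒_     : Op₂ Carrier
    ∼_      : Op₁ Carrier
    1#      : Carrier

  -- x →_N y, where → itself is rendered _⇒_
  _⇒ₙ_ : Op₂ Carrier
  x ⇒ₙ y = x ⇒ x ∧ y

  open AlgebraDefinitions _≈_ using (Congruent₁; Congruent₂)

  field
    isEquivalence : IsEquivalence _≈_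
    ∧-cong : Congruent₂ _∧_
    ∨-cong : Congruent₂ _∨_
    ⇒-cong : Congruent₂ _⇒_
    ∼-cong : Congruent₁ ∼_
    SN1  : ∀ x y → x ∧ (x ∨ y) ≈ x
    SN2  : ∀ x y z → x ∧ (y ∨ z) ≈ (z ∧ x) ∨ (y ∧ x)
    SN3  : ∀ x → ∼ ∼ x ≈ x
    SN4  : ∀ x y → ∼ (x ∧ y) ≈ ∼ x ∨ ∼ y
    SN5  : ∀ x y → x ∧ ∼ x ≈ (x ∧ ∼ x) ∧ (y ∨ ∼ y)
    SN6  : ∀ x y → x ∧ (x ⇒ₙ y) ≈ x ∧ (∼ x ∨ y)
    SN7  : ∀ x y z → (x ⇒ₙ (y ⇒ₙ z)) ≈ (x ∧ y ⇒ₙ z)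
    SN8  : ∀ x y z →
           ((x ⇒ₙ y) ⇒ₙ ((y ⇒ₙ x) ⇒ₙ ((x ⇒ z) ⇒ₙ (y ⇒ z)))) ≈ 1#
    SN9  : ∀ x y z →
           ((x ⇒ₙ y) ⇒ₙ ((y ⇒ₙ x) ⇒ₙ ((z ⇒ x) ⇒ₙ (z ⇒ y)))) ≈ 1#
    SN10 : ∀ x y → ((∼ (x ⇒ y)) ⇒ₙ (x ∧ ∼ y)) ≈ 1#
    SN11 : ∀ x y → ((x ∧ ∼ y) ⇒ₙ (∼ (x ⇒ y))) ≈ 1#

  open NaturalOrder _≈_ _∧_ public using (_≤_)

  Positive : Pred Carrier ℓ
  Positive a = ∼ a ≤ a

  open IsEquivalence isEquivalence public using (refl; sym; trans)

  setoid : Setoid c ℓ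
  setoid = record { isEquivalence = isEquivalence }

{-# INLINE mkSemiNelsonAlgebra #-}

record SemiNelsonHomomorphism {c ℓ c′ ℓ′}
       (A : SemiNelsonAlgebra c ℓ) (A′ : SemiNelsonAlgebra c′ ℓ′)
       : Set (c ⊔ ℓ ⊔ c′ ⊔ ℓ′) where
  no-eta-equality
  constructor mkSemiNelsonHomomorphism
  private
    module A  = SemiNelsonAlgebra A
    module A′ = SemiNelsonAlgebra A′
  open MorphismDefinitions A.Carrier A′.Carrier A′._≈_
  field
    ⟦_⟧    : A.Carrier → A′.Carrier
    cong   : ∀ {x y} → x A.≈ y → ⟦ x ⟧ A′.≈ ⟦ y ⟧
    ∧-homo : Homomorphic₂ ⟦_⟧ A._∧_ A′._∧_
    ∨-homo : Homomorphic₂ ⟦_⟧ A._∨_ A′._∨_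
    ⇒-homo : Homomorphic₂ ⟦_⟧ A._⇒_ A′._⇒_
    ∼-homo : Homomorphic₁ ⟦_⟧ A.∼_ A′.∼_
    1-homo : Homomorphic₀ ⟦_⟧ A.1# A′.1#

{-# INLINE mkSemiNelsonHomomorphism #-}

-- x ⇨ y = x ⇒ x ∧ y is the Heyting implication of the underlying lattice,
-- which is therefore distributive.

module SemiHeytingProperties {c ℓ} (H : SemiHeytingAlgebra c ℓ) where
  open SemiHeytingAlgebra H
  private
    module L  = Lattice lattice
    module LP = AlgLatticeProperties lattice
    module O  = Order.Lattice LP.∨-∧-orderTheoreticLattice

  infixr 5 _⇨_
  _⇨_ : Op₂ Carrier
  x ⇨ y = x ⇒ x ∧ y

  transpose : ∀ {w x y} → w ∧ x ≤ y → w ≤ x ⇨ y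
  transpose {w} {x} {y} w∧x≤y = begin
    w                                ≈⟨ proj₂ ∧-identity w ⟨
    w ∧ 1#                           ≈⟨ ∧-cong refl (x⇒x≈1 (w ∧ x)) ⟨
    w ∧ (w ∧ x ⇒ w ∧ x)              ≈⟨ ∧-cong refl (⇒-cong refl w∧x≤y) ⟩
    w ∧ (w ∧ x ⇒ (w ∧ x) ∧ y)        ≈⟨ ∧-cong refl (⇒-cong refl (L.∧-assoc w x y)) ⟩
    w ∧ (w ∧ x ⇒ w ∧ x ∧ y)          ≈⟨ ∧-⇒-∧ w x (x ∧ y) ⟨
    w ∧ (x ⇒ x ∧ y)                  ∎
    where open ≈-Reasoning L.setoid

  untranspose : ∀ {w x y} → w ≤ x ⇨ y → w ∧ x ≤ y
  untranspose {w} {x} {y} w≤x⇨y = begin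
    w ∧ x            ≤⟨ MeetProperties.∧-monotonic O.meetSemilattice w≤x⇨y O.refl ⟩
    (x ⇨ y) ∧ x      ≈⟨ L.∧-comm _ _ ⟩
    x ∧ (x ⇒ x ∧ y)  ≈⟨ ∧-⇒ x (x ∧ y) ⟩
    x ∧ x ∧ y        ≤⟨ O.x∧y≤y _ _ ⟩
    x ∧ y            ≤⟨ O.x∧y≤y _ _ ⟩
    y                ∎
    where open ≤-Reasoning O.poset

  heytingAlgebra : Order.HeytingAlgebra c ℓ ℓ
  heytingAlgebra = record
    { _∨_ = _∨_ ; _∧_ = _∧_ ; _⇨_ = _⇨_ ; ⊤ = 1# ; ⊥ = 0#
    ; isHeytingAlgebra = record
      { isBoundedLattice = record
        { isLattice = LP.∨-∧-isOrderTheoreticLattice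
        ; maximum   = λ x → sym (proj₂ ∧-identity x)
        ; minimum   = λ x → O.trans (O.x≤x∨y 0# x) (O.reflexive (proj₁ ∨-identity x))
        }
      ; exponential = λ w x y → transpose , untranspose
      }
    }

  open Order.HeytingAlgebra heytingAlgebra public
    using (antisym; reflexive; maximum; minimum; x∧y≤x; x∧y≤y; ∧-greatest;
           x≤x∨y; y≤x∨y; ∨-least; transpose-⇨; transpose-∧; poset)
    renaming (refl to ≤-refl; trans to ≤-trans)
  open HeytingProperties heytingAlgebra public
    using (∧-distribˡ-∨; distributiveLattice; ⇨-cong; ⇨-curry)
  open DistributiveProperties distributiveLattice public
    using (∧-distribʳ-∨; ∨-distribˡ-∧)
  open MeetProperties (Order.HeytingAlgebra.meetSemilattice heytingAlgebra) public
    using (∧-monotonic; ∧-comm; ∧-assoc; ∧-idempotent)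
  open JoinProperties (Order.HeytingAlgebra.joinSemilattice heytingAlgebra) public
    using (∨-monotonic; ∨-comm; ∨-assoc; ∨-idempotent)

  ≤0⇒≈0 : ∀ {x} → x ≤ 0# → x ≈ 0#
  ≤0⇒≈0 x≤0 = antisym x≤0 (minimum _)

  ∧-∨-disjoint : ∀ {a b d} → a ∧ b ≈ 0# → a ∧ (b ∨ d) ≈ a ∧ d
  ∧-∨-disjoint {a} {b} {d} ab≈0 = begin
    a ∧ (b ∨ d)     ≈⟨ ∧-distribˡ-∨ a b d ⟩
    a ∧ b ∨ a ∧ d   ≈⟨ ∨-cong ab≈0 refl ⟩
    0# ∨ a ∧ d      ≈⟨ proj₁ ∨-identity _ ⟩
    a ∧ d           ∎
    where open ≈-Reasoning L.setoid

  ⇒-relativeˡ : ∀ {u a c e} → u ∧ a ≈ u ∧ c → u ∧ (a ⇒ e) ≈ u ∧ (c ⇒ e)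
  ⇒-relativeˡ {u} {a} {c} {e} ua≈uc =
    trans (∧-⇒-∧ u a e)
   (trans (∧-cong refl (⇒-cong ua≈uc refl)) (sym (∧-⇒-∧ u c e)))

  ⇒-relativeʳ : ∀ {u a c e} → u ∧ a ≈ u ∧ c → u ∧ (e ⇒ a) ≈ u ∧ (e ⇒ c)
  ⇒-relativeʳ {u} {a} {c} {e} ua≈uc =
    trans (∧-⇒-∧ u e a)
   (trans (∧-cong refl (⇒-cong refl ua≈uc)) (sym (∧-⇒-∧ u e c)))

module _ {c ℓ p} (H : SemiHeytingAlgebra c ℓ)
         {F : Pred (SemiHeytingAlgebra.Carrier H) p} (isIFilter : IsIFilter H F) where
  open SemiHeytingAlgebra H
  open SemiHeytingProperties H
  open IsIFilter isIFilter using (resp; nonempty; upward; ∧-closed; ⇒-closed)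

  record NPair : Set (c ⊔ ℓ ⊔ p) where
    constructor npair
    field
      fst      : Carrier
      snd      : Carrier
      disjoint : fst ∧ snd ≈ 0#
      covered  : fst ∨ snd ∈ F

  open NPair

  private
    infix 4 _≈ₙ_
    _≈ₙ_ : Rel NPair ℓ
    x ≈ₙ y = fst x ≈ fst y × snd x ≈ snd y

    ⊓ₙ-disjoint : ∀ {a b c d} → a ∧ b ≈ 0# → c ∧ d ≈ 0# → (a ∧ c) ∧ (b ∨ d) ≈ 0#
    ⊓ₙ-disjoint {a} {b} {c} {d} ab cd = ≤0⇒≈0 $ ≤-trans
      (reflexive (∧-distribˡ-∨ (a ∧ c) b d))
      (∨-least (≤-trans (∧-monotonic (x∧y≤x a c) ≤-refl) (reflexive ab))
               (≤-trans (∧-monotonic (x∧y≤y a c) ≤-refl) (reflexive cd)))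

    ⊓ₙ-covered : ∀ {a b c d} → a ∨ b ∈ F → c ∨ d ∈ F → (a ∧ c) ∨ (b ∨ d) ∈ F
    ⊓ₙ-covered {a} {b} {c} {d} ab cd = upward le (∧-closed ab cd)
      where
      le : (a ∨ b) ∧ (c ∨ d) ≤ (a ∧ c) ∨ (b ∨ d)
      le = ≤-trans (reflexive (∧-distribʳ-∨ (c ∨ d) a b))
        (∨-least
          (≤-trans (reflexive (∧-distribˡ-∨ a c d))
            (∨-least (x≤x∨y _ _)
              (≤-trans (x∧y≤y a d) (≤-trans (y≤x∨y b d) (y≤x∨y _ _)))))
          (≤-trans (x∧y≤x b (c ∨ d)) (≤-trans (x≤x∨y b d) (y≤x∨y _ _))))

  infixr 7 _⊓ₙ_
  _⊓ₙ_ : Op₂ NPair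
  npair a b ab ab∈F ⊓ₙ npair c d cd cd∈F =
    npair (a ∧ c) (b ∨ d) (⊓ₙ-disjoint ab cd) (⊓ₙ-covered ab∈F cd∈F)

  ∼ₙ_ : Op₁ NPair
  ∼ₙ npair a b ab ab∈F =
    npair b a (trans (∧-comm b a) ab) (resp (∨-comm a b) ab∈F)

  infixr 6 _⊔ₙ_
  _⊔ₙ_ : Op₂ NPair
  npair a b ab ab∈F ⊔ₙ npair c d cd cd∈F =
    npair (a ∨ c) (b ∧ d)
      (trans (∧-comm _ _) (⊓ₙ-disjoint (trans (∧-comm b a) ab) (trans (∧-comm d c) cd)))
      (resp (∨-comm _ _) (⊓ₙ-covered (resp (∨-comm a b) ab∈F) (resp (∨-comm c d) cd∈F)))

  infixr 5 _⟶_
  _⟶_ : Op₂ NPair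
  npair a b ab ab∈F ⟶ npair c d cd cd∈F =
    npair (a ⇒ c) (a ∧ d) disj (⇒-closed cd∈F a)
    where
    disj : (a ⇒ c) ∧ (a ∧ d) ≈ 0#
    disj = ≤0⇒≈0 (begin
      (a ⇒ c) ∧ (a ∧ d)  ≈⟨ ∧-assoc _ _ _ ⟨
      ((a ⇒ c) ∧ a) ∧ d  ≈⟨ ∧-cong (∧-comm _ _) refl ⟩
      (a ∧ (a ⇒ c)) ∧ d  ≈⟨ ∧-cong (∧-⇒ a c) refl ⟩
      (a ∧ c) ∧ d        ≈⟨ ∧-assoc _ _ _ ⟩
      a ∧ (c ∧ d)        ≤⟨ x∧y≤y _ _ ⟩
      c ∧ d              ≈⟨ cd ⟩
      0#                 ∎)
      where open ≤-Reasoning poset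

  ⊤ₙ : NPair
  ⊤ₙ = npair 1# 0# (proj₁ ∧-identity 0#)
         (upward (≤-trans (maximum _) (x≤x∨y 1# 0#)) (proj₂ nonempty))

  private
    infixr 5 _⟶ₙ_
    _⟶ₙ_ : Op₂ NPair
    x ⟶ₙ y = x ⟶ x ⊓ₙ y

    ⟶ₙ-top : ∀ u v → fst u ≤ fst v → (u ⟶ₙ v) ≈ₙ ⊤ₙ
    ⟶ₙ-top u v u≤v =
      trans (⇒-cong refl (sym u≤v)) (x⇒x≈1 (fst u)) ,
      trans (∧-∨-disjoint (disjoint u))
            (≤0⇒≈0 (≤-trans (∧-monotonic u≤v ≤-refl) (reflexive (disjoint v))))

    agree : ∀ a c → let u = (a ⇨ c) ∧ (c ⇨ a) in u ∧ a ≈ u ∧ c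
    agree a c = antisym
      (∧-greatest (x∧y≤x _ _) (untranspose (x∧y≤x _ _)))
      (∧-greatest (x∧y≤x _ _) (untranspose (x∧y≤y _ _)))

    SN5ₙ : ∀ x y → (x ⊓ₙ ∼ₙ x) ≈ₙ (x ⊓ₙ ∼ₙ x) ⊓ₙ (y ⊔ₙ ∼ₙ y)
    SN5ₙ (npair a b ab _) (npair c d cd _) =
      antisym (≤-trans (reflexive ab) (minimum _)) (x∧y≤x _ _) ,
      antisym (x≤x∨y _ _)
        (∨-least ≤-refl (≤-trans (reflexive (trans (∧-comm d c) cd)) (minimum _)))

    SN6ₙ : ∀ x y → (x ⊓ₙ (x ⟶ₙ y)) ≈ₙ (x ⊓ₙ (∼ₙ x ⊔ₙ y))
    SN6ₙ (npair a b ab _) (npair c d cd _) =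
      trans (∧-⇒ a (a ∧ c))
        (trans (trans (sym (∧-assoc a a c)) (∧-cong (∧-idempotent a) refl))
               (sym (∧-∨-disjoint ab))) ,
      ∨-cong refl (∧-∨-disjoint ab)

    SN7ₙ : ∀ x y z → (x ⟶ₙ (y ⟶ₙ z)) ≈ₙ (x ⊓ₙ y ⟶ₙ z)
    SN7ₙ x y z =
      sym ⇨-curry ,
      trans (∧-∨-disjoint (disjoint x))
        (trans (∧-cong refl (∧-∨-disjoint (disjoint y)))
          (trans (sym (∧-assoc _ _ _)) (sym (∧-∨-disjoint (disjoint (x ⊓ₙ y))))))

    SN8ₙ : ∀ x y z →
           ((x ⟶ₙ y) ⟶ₙ ((y ⟶ₙ x) ⟶ₙ ((x ⟶ z) ⟶ₙ (y ⟶ z)))) ≈ₙ ⊤ₙ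
    SN8ₙ x y z = ⟶ₙ-top (x ⟶ₙ y) ((y ⟶ₙ x) ⟶ₙ ((x ⟶ z) ⟶ₙ (y ⟶ z)))
      (transpose (transpose (≤-trans
        (reflexive (⇒-relativeˡ (agree (fst x) (fst y)))) (x∧y≤y _ _))))

    SN9ₙ : ∀ x y z →
           ((x ⟶ₙ y) ⟶ₙ ((y ⟶ₙ x) ⟶ₙ ((z ⟶ x) ⟶ₙ (z ⟶ y)))) ≈ₙ ⊤ₙ
    SN9ₙ x y z = ⟶ₙ-top (x ⟶ₙ y) ((y ⟶ₙ x) ⟶ₙ ((z ⟶ x) ⟶ₙ (z ⟶ y)))
      (transpose (transpose (≤-trans
        (reflexive (⇒-relativeʳ (agree (fst x) (fst y)))) (x∧y≤y _ _))))

  -- pairs are equal when their components are; the membership proofs are ignored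
  N : SemiNelsonAlgebra (c ⊔ ℓ ⊔ p) ℓ
  N = record
    { Carrier = NPair
    ; _≈_ = λ x y → fst x ≈ fst y × snd x ≈ snd y
    ; _∧_ = _⊓ₙ_
    ; _∨_ = _⊔ₙ_
    ; _⇒_ = _⟶_
    ; ∼_  = ∼ₙ_
    ; 1#  = ⊤ₙ
    ; isEquivalence = record
      { refl  = refl , refl
      ; sym   = λ (p , q) → sym p , sym q
      ; trans = λ (p , q) (r , s) → trans p r , trans q s
      }
    ; ∧-cong = λ (p , q) (r , s) → ∧-cong p r , ∨-cong q s
    ; ∨-cong = λ (p , q) (r , s) → ∨-cong p r , ∧-cong q s
    ; ⇒-cong = λ (p , q) (r , s) → ⇒-cong p r , ∧-cong p s
    ; ∼-cong = λ (p , q) → q , p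
    ; SN1  = λ x y → ∧-absorbs-∨ _ _ , ∨-absorbs-∧ _ _
    ; SN2  = λ x y z →
        trans (∧-distribˡ-∨ _ _ _)
          (trans (∨-comm _ _) (∨-cong (∧-comm _ _) (∧-comm _ _))) ,
        trans (∨-distribˡ-∧ _ _ _)
          (trans (∧-comm _ _) (∧-cong (∨-comm _ _) (∨-comm _ _)))
    ; SN3  = λ x → refl , refl
    ; SN4  = λ x y → refl , refl
    ; SN5  = SN5ₙ
    ; SN6  = SN6ₙ
    ; SN7  = SN7ₙ
    ; SN8  = SN8ₙ
    ; SN9  = SN9ₙ
    ; SN10 = λ x y → ⟶ₙ-top (∼ₙ (x ⟶ y)) (x ⊓ₙ ∼ₙ y) ≤-refl
    ; SN11 = λ x y → ⟶ₙ-top (x ⊓ₙ ∼ₙ y) (∼ₙ (x ⟶ y)) ≤-refl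
    }
    where open IsLattice isLattice using (∧-absorbs-∨; ∨-absorbs-∧)

module SemiNelsonProperties {c ℓ} (A : SemiNelsonAlgebra c ℓ) where
  open SemiNelsonAlgebra A
  private
    module ≈R = ≈-Reasoning setoid

  -- SN1 and SN2 are Sholander's axioms for distributive lattices

  ∧-idem : ∀ x → x ∧ x ≈ x
  ∧-idem x = begin
    x ∧ x                        ≈⟨ ∧-cong refl x≈ ⟩
    x ∧ (x ∧ x ∨ x ∧ x)          ≈⟨ SN2 x (x ∧ x) (x ∧ x) ⟩
    (x ∧ x) ∧ x ∨ (x ∧ x) ∧ x    ≈⟨ ∨-cong x²x x²x ⟩
    x ∧ x ∨ x ∧ x                ≈⟨ x≈ ⟨
    x                            ∎
    where
    open ≈R
    x≈ : x ≈ x ∧ x ∨ x ∧ x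
    x≈ = trans (sym (SN1 x x)) (SN2 x x x)
    x²x : (x ∧ x) ∧ x ≈ x ∧ x
    x²x = trans (∧-cong refl x≈) (SN1 (x ∧ x) (x ∧ x))

  ∨-idem : ∀ x → x ∨ x ≈ x
  ∨-idem x = begin
    x ∨ x            ≈⟨ ∨-cong (∧-idem x) (∧-idem x) ⟨
    x ∧ x ∨ x ∧ x    ≈⟨ SN2 x x x ⟨
    x ∧ (x ∨ x)      ≈⟨ SN1 x x ⟩
    x                ∎
    where open ≈R

  ∧-comm : ∀ x y → x ∧ y ≈ y ∧ x
  ∧-comm x y = begin
    x ∧ y            ≈⟨ ∧-cong refl (∨-idem y) ⟨
    x ∧ (y ∨ y)      ≈⟨ SN2 x y y ⟩
    y ∧ x ∨ y ∧ x    ≈⟨ ∨-idem (y ∧ x) ⟩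
    y ∧ x            ∎
    where open ≈R

  y∧x∨x≈x : ∀ x y → y ∧ x ∨ x ≈ x
  y∧x∨x≈x x y = begin
    y ∧ x ∨ x        ≈⟨ ∨-cong refl (∧-idem x) ⟨
    y ∧ x ∨ x ∧ x    ≈⟨ SN2 x x y ⟨
    x ∧ (x ∨ y)      ≈⟨ SN1 x y ⟩
    x                ∎
    where open ≈R

  ∨-absorbs-∧ : ∀ x y → x ∨ x ∧ y ≈ x
  ∨-absorbs-∧ x y = begin
    x ∨ w                                ≈⟨ ∧-idem (x ∨ w) ⟨
    (x ∨ w) ∧ (x ∨ w)                    ≈⟨ SN2 (x ∨ w) x w ⟩
    w ∧ (x ∨ w) ∨ x ∧ (x ∨ w)            ≈⟨ ∨-cong w∧ (SN1 x w) ⟩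
    w ∨ x                                ≈⟨ ∨-cong (∧-comm x y) refl ⟩
    y ∧ x ∨ x                            ≈⟨ y∧x∨x≈x x y ⟩
    x                                    ∎
    where
    open ≈R
    w = x ∧ y
    x∧w : x ∧ w ≈ w
    x∧w = begin
      x ∧ w              ≈⟨ ∧-comm x w ⟩
      w ∧ x              ≈⟨ ∧-cong refl (trans (sym (y∧x∨x≈x x y))
                              (∨-cong (∧-comm y x) refl)) ⟩
      w ∧ (w ∨ x)        ≈⟨ SN1 w x ⟩
      w                  ∎
    w∧ : w ∧ (x ∨ w) ≈ w
    w∧ = begin
      w ∧ (x ∨ w)        ≈⟨ SN2 w x w ⟩
      w ∧ w ∨ x ∧ w      ≈⟨ ∨-cong (∧-idem w) x∧w ⟩
      w ∨ w              ≈⟨ ∨-idem w ⟩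
      w                  ∎

  y∧[x∨y]≈y : ∀ x y → y ∧ (x ∨ y) ≈ y
  y∧[x∨y]≈y x y = begin
    y ∧ (x ∨ y)          ≈⟨ SN2 y x y ⟩
    y ∧ y ∨ x ∧ y        ≈⟨ ∨-cong (∧-idem y) (∧-comm x y) ⟩
    y ∨ y ∧ x            ≈⟨ ∨-absorbs-∧ y x ⟩
    y                    ∎
    where open ≈R

  ∨-comm : ∀ x y → x ∨ y ≈ y ∨ x
  ∨-comm x y = begin
    x ∨ y                                ≈⟨ ∧-idem (x ∨ y) ⟨
    (x ∨ y) ∧ (x ∨ y)                    ≈⟨ SN2 (x ∨ y) x y ⟩
    y ∧ (x ∨ y) ∨ x ∧ (x ∨ y)            ≈⟨ ∨-cong (y∧[x∨y]≈y x y) (SN1 x y) ⟩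
    y ∨ x                                ∎
    where open ≈R

  ∧-distrib : ∀ x y z → x ∧ (y ∨ z) ≈ x ∧ y ∨ x ∧ z
  ∧-distrib x y z =
    trans (SN2 x y z) (trans (∨-comm _ _) (∨-cong (∧-comm y x) (∧-comm z x)))

  ∨-assoc : ∀ x y z → (x ∨ y) ∨ z ≈ x ∨ (y ∨ z)
  ∨-assoc x y z = trans (sym qp) (trans (∧-comm q p) pq)
    where
    open ≈R
    p = x ∨ (y ∨ z)
    q = (x ∨ y) ∨ z
    upˡ : ∀ {t u} v → t ∧ u ≈ t → t ∧ (u ∨ v) ≈ t
    upˡ {t} {u} v tu = begin
      t ∧ (u ∨ v)     ≈⟨ ∧-distrib t u v ⟩
      t ∧ u ∨ t ∧ v   ≈⟨ ∨-cong tu refl ⟩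
      t ∨ t ∧ v       ≈⟨ ∨-absorbs-∧ t v ⟩
      t               ∎
    upʳ : ∀ {t u} v → t ∧ u ≈ t → t ∧ (v ∨ u) ≈ t
    upʳ v tu = trans (∧-cong refl (∨-comm v _)) (upˡ v tu)
    lub : ∀ {t u v} → t ∧ v ≈ t → u ∧ v ≈ u → (t ∨ u) ∧ v ≈ t ∨ u
    lub {t} {u} {v} tv uv = begin
      (t ∨ u) ∧ v     ≈⟨ ∧-comm _ v ⟩
      v ∧ (t ∨ u)     ≈⟨ ∧-distrib v t u ⟩
      v ∧ t ∨ v ∧ u   ≈⟨ ∨-cong (trans (∧-comm v t) tv) (trans (∧-comm v u) uv) ⟩
      t ∨ u           ∎
    pq : p ∧ q ≈ p
    pq = lub (upˡ z (SN1 x y)) (lub (upˡ z (y∧[x∨y]≈y x y)) (y∧[x∨y]≈y (x ∨ y) z))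
    qp : q ∧ p ≈ q
    qp = lub (lub (SN1 x (y ∨ z)) (upʳ x (SN1 y z))) (upʳ x (y∧[x∨y]≈y y z))

  ∼-injective : ∀ {x y} → ∼ x ≈ ∼ y → x ≈ y
  ∼-injective {x} {y} e = trans (sym (SN3 x)) (trans (∼-cong e) (SN3 y))

  ∼-∨ : ∀ x y → ∼ (x ∨ y) ≈ ∼ x ∧ ∼ y
  ∼-∨ x y = ∼-injective (begin
    ∼ ∼ (x ∨ y)        ≈⟨ SN3 _ ⟩
    x ∨ y              ≈⟨ ∨-cong (SN3 x) (SN3 y) ⟨
    ∼ ∼ x ∨ ∼ ∼ y      ≈⟨ SN4 (∼ x) (∼ y) ⟨
    ∼ (∼ x ∧ ∼ y)      ∎)
    where open ≈R

  ∧-assoc : ∀ x y z → (x ∧ y) ∧ z ≈ x ∧ (y ∧ z)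
  ∧-assoc x y z = ∼-injective (begin
    ∼ ((x ∧ y) ∧ z)      ≈⟨ trans (SN4 _ z) (∨-cong (SN4 x y) refl) ⟩
    (∼ x ∨ ∼ y) ∨ ∼ z    ≈⟨ ∨-assoc _ _ _ ⟩
    ∼ x ∨ (∼ y ∨ ∼ z)    ≈⟨ trans (SN4 x _) (∨-cong refl (SN4 y z)) ⟨
    ∼ (x ∧ (y ∧ z))      ∎)
    where open ≈R

  lattice : Lattice c ℓ
  lattice = record
    { _≈_ = _≈_ ; _∨_ = _∨_ ; _∧_ = _∧_
    ; isLattice = record
      { isEquivalence = isEquivalence
      ; ∨-comm  = ∨-comm
      ; ∨-assoc = ∨-assoc
      ; ∨-cong  = ∨-cong
      ; ∧-comm  = ∧-comm
      ; ∧-assoc = ∧-assoc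
      ; ∧-cong  = ∧-cong
      ; absorptive = ∨-absorbs-∧ , SN1
      }
    }

  private
    orderLattice : Order.Lattice c ℓ ℓ
    orderLattice = AlgLatticeProperties.∨-∧-orderTheoreticLattice lattice

  open Order.Lattice orderLattice public
    using (antisym; reflexive; x∧y≤x; x∧y≤y; ∧-greatest; x≤x∨y; y≤x∨y; ∨-least; poset)
    renaming (refl to ≤-refl; trans to ≤-trans)
  open MeetProperties (Order.Lattice.meetSemilattice orderLattice) public
    using (∧-monotonic)
  open JoinProperties (Order.Lattice.joinSemilattice orderLattice) public
    using (∨-monotonic)

  private
    module ≤R = ≤-Reasoning poset

  ∨-distrib : ∀ x y z → x ∨ y ∧ z ≈ (x ∨ y) ∧ (x ∨ z)
  ∨-distrib = DistributiveProperties.∨-distribˡ-∧ (record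
    { isDistributiveLattice = record
      { isLattice = Order.Lattice.isLattice orderLattice
      ; ∧-distribˡ-∨ = ∧-distrib
      }
    })

  ∼-antitone : ∀ {x y} → x ≤ y → ∼ y ≤ ∼ x
  ∼-antitone {x} {y} x≤y =
    ≤-trans (y≤x∨y (∼ x) (∼ y)) (reflexive (sym (trans (∼-cong x≤y) (SN4 x y))))

  kleene : ∀ x y → x ∧ ∼ x ≤ y ∨ ∼ y
  kleene = SN5

  ⇒ₙ-cong : ∀ {x x′ y y′} → x ≈ x′ → y ≈ y′ → (x ⇒ₙ y) ≈ (x′ ⇒ₙ y′)
  ⇒ₙ-cong p q = ⇒-cong p (∧-cong p q)

  ⇒ₙ-refl-⇒ : ∀ x → (x ⇒ₙ x) ≈ (x ⇒ x)
  ⇒ₙ-refl-⇒ x = ⇒-cong refl (∧-idem x)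

  ⇒ₙ-contract : ∀ x y → (x ⇒ₙ (x ⇒ₙ y)) ≈ (x ⇒ₙ y)
  ⇒ₙ-contract x y = trans (SN7 x x y) (⇒ₙ-cong (∧-idem x) refl)

  private
    e : Op₁ Carrier
    e x = x ⇒ₙ x

    x≤ex : ∀ x → x ≤ e x
    x≤ex x = sym (begin
      x ∧ (x ⇒ₙ x)   ≈⟨ SN6 x x ⟩
      x ∧ (∼ x ∨ x)  ≈⟨ y∧[x∨y]≈y (∼ x) x ⟩
      x              ∎)
      where open ≈R

    eex≈1 : ∀ x → e (e x) ≈ 1#
    eex≈1 x = begin
      a ⇒ₙ a                     ≈⟨ ⇒ₙ-contract a a ⟨
      a ⇒ₙ (a ⇒ₙ a)              ≈⟨ ⇒ₙ-contract a (a ⇒ₙ a) ⟨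
      a ⇒ₙ (a ⇒ₙ (a ⇒ₙ a))       ≈⟨ ⇒ₙ-cong refl (⇒ₙ-cong refl (⇒ₙ-cong a≈ a≈)) ⟩
      a ⇒ₙ (a ⇒ₙ ((x ⇒ x) ⇒ₙ (x ⇒ x)))  ≈⟨ SN8 x x x ⟩
      1#                         ∎
      where
      open ≈R
      a = e x
      a≈ : a ≈ (x ⇒ x)
      a≈ = ⇒ₙ-refl-⇒ x

  0# : Carrier
  0# = ∼ 1#

  maximum : ∀ x → x ≤ 1#
  maximum x = ≤-trans (x≤ex x) (≤-trans (x≤ex (e x)) (reflexive (eex≈1 x)))

  minimum : ∀ x → 0# ≤ x
  minimum x = ≤-trans (∼-antitone (maximum (∼ x))) (reflexive (SN3 x))

  1∧x≈x : ∀ x → 1# ∧ x ≈ x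
  1∧x≈x x = antisym (x∧y≤y 1# x) (∧-greatest (maximum x) ≤-refl)

  1⇒ₙx≈x : ∀ x → (1# ⇒ₙ x) ≈ x
  1⇒ₙx≈x x = begin
    1# ⇒ₙ x             ≈⟨ 1∧x≈x _ ⟨
    1# ∧ (1# ⇒ₙ x)      ≈⟨ SN6 1# x ⟩
    1# ∧ (0# ∨ x)       ≈⟨ 1∧x≈x _ ⟩
    0# ∨ x              ≈⟨ antisym (∨-least (minimum x) ≤-refl) (y≤x∨y 0# x) ⟩
    x                   ∎
    where open ≈R

  1⇒x≈x : ∀ x → (1# ⇒ x) ≈ x
  1⇒x≈x x = trans (⇒-cong refl (sym (1∧x≈x x))) (1⇒ₙx≈x x)

  x⇒ₙx≈1 : ∀ x → (x ⇒ₙ x) ≈ 1#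
  x⇒ₙx≈1 x = begin
    x ⇒ₙ x                               ≈⟨ ⇒ₙ-cong (1⇒x≈x x) (1⇒x≈x x) ⟨
    (1# ⇒ x) ⇒ₙ (1# ⇒ x)                 ≈⟨ 1⇒ₙx≈x _ ⟨
    1# ⇒ₙ ((1# ⇒ x) ⇒ₙ (1# ⇒ x))         ≈⟨ 1⇒ₙx≈x _ ⟨
    1# ⇒ₙ (1# ⇒ₙ ((1# ⇒ x) ⇒ₙ (1# ⇒ x))) ≈⟨ ⇒ₙ-cong e1 (⇒ₙ-cong e1 refl) ⟨
    e 1# ⇒ₙ (e 1# ⇒ₙ ((1# ⇒ x) ⇒ₙ (1# ⇒ x)))  ≈⟨ SN8 1# 1# x ⟩
    1#                                   ∎
    where
    open ≈R
    e1 : e 1# ≈ 1#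
    e1 = 1⇒ₙx≈x 1#

  x⇒x≈1 : ∀ x → (x ⇒ x) ≈ 1#
  x⇒x≈1 x = trans (sym (⇒ₙ-refl-⇒ x)) (x⇒ₙx≈1 x)

  -- The preorder whose associated equivalence is the congruence ≋ below

  infix 4 _⊑_
  _⊑_ : Rel Carrier ℓ
  x ⊑ y = (x ⇒ₙ y) ≈ 1#

  ≤⇒⊑ : ∀ {x y} → x ≤ y → x ⊑ y
  ≤⇒⊑ {x} x≤y = trans (⇒-cong refl (sym x≤y)) (x⇒x≈1 x)

  ⊑-refl : ∀ {x} → x ⊑ x
  ⊑-refl = ≤⇒⊑ ≤-refl

  ⊑⇒≤ : ∀ {x y} → x ⊑ y → x ≤ ∼ x ∨ y
  ⊑⇒≤ {x} {y} x⊑y = begin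
    x                   ≈⟨ trans (∧-comm x 1#) (1∧x≈x x) ⟨
    x ∧ 1#              ≈⟨ ∧-cong refl x⊑y ⟨
    x ∧ (x ⇒ₙ y)        ≈⟨ SN6 x y ⟩
    x ∧ (∼ x ∨ y)       ≤⟨ x∧y≤y x _ ⟩
    ∼ x ∨ y             ∎
    where open ≤R

  ≤⇒⊑′ : ∀ {x y} → x ≤ ∼ x ∨ y → x ⊑ y
  ≤⇒⊑′ {x} {y} x≤ = begin
    x ⇒ₙ y              ≈⟨ ⇒ₙ-contract x y ⟨
    x ⇒ₙ (x ⇒ₙ y)       ≈⟨ ⇒-cong refl (trans (SN6 x y) (sym x≤)) ⟩
    x ⇒ x               ≈⟨ x⇒x≈1 x ⟩
    1#                  ∎
    where open ≈R

  1⊑⇒≈1 : ∀ {x} → 1# ⊑ x → x ≈ 1#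
  1⊑⇒≈1 {x} 1⊑x = trans (sym (1⇒ₙx≈x x)) 1⊑x

  ⊑-curry : ∀ {x y z} → x ∧ y ⊑ z → x ⊑ (y ⇒ₙ z)
  ⊑-curry p = trans (SN7 _ _ _) p

  ⊑-uncurry : ∀ {x y z} → x ⊑ (y ⇒ₙ z) → x ∧ y ⊑ z
  ⊑-uncurry p = trans (sym (SN7 _ _ _)) p

  ⊑-trans : ∀ {x y z} → x ⊑ y → y ⊑ z → x ⊑ z
  ⊑-trans {x} {y} {z} x⊑y y⊑z = ≤⇒⊑′ (begin
    x                                 ≤⟨ ∧-greatest ≤-refl (⊑⇒≤ x⊑y) ⟩
    x ∧ (∼ x ∨ y)                     ≈⟨ ∧-distrib x (∼ x) y ⟩
    x ∧ ∼ x ∨ x ∧ y                   ≤⟨ ∨-least (≤-trans (x∧y≤y x (∼ x)) (x≤x∨y _ _)) x∧y≤ ⟩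
    ∼ x ∨ z                           ∎)
    where
    open ≤R
    ∼[∼x∨z] : ∼ (∼ x ∨ z) ≤ ∼ (x ∧ (y ∧ ∼ y))
    ∼[∼x∨z] = begin
      ∼ (∼ x ∨ z)           ≈⟨ ∼-∨ (∼ x) z ⟩
      ∼ ∼ x ∧ ∼ z           ≤⟨ x∧y≤x _ _ ⟩
      ∼ ∼ x                 ≈⟨ SN3 x ⟩
      x                     ≤⟨ ⊑⇒≤ x⊑y ⟩
      ∼ x ∨ y               ≈⟨ ∨-cong refl (SN3 y) ⟨
      ∼ x ∨ ∼ ∼ y           ≤⟨ ∨-monotonic ≤-refl (y≤x∨y (∼ y) (∼ ∼ y)) ⟩
      ∼ x ∨ (∼ y ∨ ∼ ∼ y)   ≈⟨ ∨-cong refl (SN4 y (∼ y)) ⟨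
      ∼ x ∨ ∼ (y ∧ ∼ y)     ≈⟨ SN4 x (y ∧ ∼ y) ⟨
      ∼ (x ∧ (y ∧ ∼ y))     ∎
    cut : x ∧ (y ∧ ∼ y) ≤ ∼ x ∨ z
    cut = ≤-trans (reflexive (sym (SN3 _)))
          (≤-trans (∼-antitone ∼[∼x∨z]) (reflexive (SN3 _)))
    x∧y≤ : x ∧ y ≤ ∼ x ∨ z
    x∧y≤ = begin
      x ∧ y                         ≤⟨ ∧-monotonic ≤-refl (∧-greatest ≤-refl (⊑⇒≤ y⊑z)) ⟩
      x ∧ (y ∧ (∼ y ∨ z))           ≈⟨ ∧-cong refl (∧-distrib y (∼ y) z) ⟩
      x ∧ (y ∧ ∼ y ∨ y ∧ z)         ≈⟨ ∧-distrib x _ _ ⟩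
      x ∧ (y ∧ ∼ y) ∨ x ∧ (y ∧ z)   ≤⟨ ∨-least cut
        (≤-trans (x∧y≤y x _) (≤-trans (x∧y≤y y z) (y≤x∨y (∼ x) z))) ⟩
      ∼ x ∨ z                       ∎

  ⊑-∧-greatest : ∀ {x y z} → x ⊑ y → x ⊑ z → x ⊑ y ∧ z
  ⊑-∧-greatest {x} {y} {z} p q = ≤⇒⊑′
    (≤-trans (∧-greatest (⊑⇒≤ p) (⊑⇒≤ q)) (reflexive (sym (∨-distrib (∼ x) y z))))

  ⊑-∨-least : ∀ {x y z} → x ⊑ z → y ⊑ z → x ∨ y ⊑ z
  ⊑-∨-least {x} {y} {z} p q = ≤⇒⊑′ (begin
    x ∨ y                    ≤⟨ ∧-greatest (∨-least (⊑⇒≤ p) (half q p))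
                                           (∨-least (half p q) (⊑⇒≤ q)) ⟩
    (∼ x ∨ z) ∧ (∼ y ∨ z)    ≈⟨ ∧-cong (∨-comm _ _) (∨-comm _ _) ⟩
    (z ∨ ∼ x) ∧ (z ∨ ∼ y)    ≈⟨ ∨-distrib z (∼ x) (∼ y) ⟨
    z ∨ ∼ x ∧ ∼ y            ≈⟨ ∨-comm _ _ ⟩
    ∼ x ∧ ∼ y ∨ z            ≈⟨ ∨-cong (∼-∨ x y) refl ⟨
    ∼ (x ∨ y) ∨ z            ∎)
    where
    open ≤R
    half : ∀ {x y} → x ⊑ z → y ⊑ z → x ≤ ∼ y ∨ z
    half {x} {y} p q = begin
      x                      ≤⟨ ∧-greatest ≤-refl (⊑⇒≤ p) ⟩
      x ∧ (∼ x ∨ z)          ≈⟨ ∧-distrib x (∼ x) z ⟩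
      x ∧ ∼ x ∨ x ∧ z        ≤⟨ ∨-monotonic (kleene x y) (x∧y≤y x z) ⟩
      (y ∨ ∼ y) ∨ z          ≤⟨ ∨-least (∨-least (⊑⇒≤ q) (x≤x∨y _ _)) (y≤x∨y _ _) ⟩
      ∼ y ∨ z                ∎

  -- the instances of SN8 with 1 as one of the two compared elements
  ∧-⇒-⊑ : ∀ {x y} → x ∧ (x ⇒ y) ⊑ y
  ∧-⇒-⊑ {x} {y} = ⊑-uncurry (begin
    x ⇒ₙ ((x ⇒ y) ⇒ₙ y)
      ≈⟨ ⇒ₙ-cong (1⇒ₙx≈x x) (⇒ₙ-cong refl (1⇒x≈x y)) ⟨
    (1# ⇒ₙ x) ⇒ₙ ((x ⇒ y) ⇒ₙ (1# ⇒ y))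
      ≈⟨ 1⇒ₙx≈x _ ⟨
    1# ⇒ₙ ((1# ⇒ₙ x) ⇒ₙ ((x ⇒ y) ⇒ₙ (1# ⇒ y)))
      ≈⟨ ⇒ₙ-cong (≤⇒⊑ (maximum x)) refl ⟨
    (x ⇒ₙ 1#) ⇒ₙ ((1# ⇒ₙ x) ⇒ₙ ((x ⇒ y) ⇒ₙ (1# ⇒ y)))
      ≈⟨ SN8 x 1# y ⟩
    1# ∎)
    where open ≈R

  ∧-⊑-⇒ : ∀ {x y} → x ∧ y ⊑ (x ⇒ y)
  ∧-⊑-⇒ {x} {y} = ⊑-uncurry (begin
    x ⇒ₙ (y ⇒ₙ (x ⇒ y))
      ≈⟨ ⇒ₙ-cong (1⇒ₙx≈x x) (⇒ₙ-cong (1⇒x≈x y) refl) ⟨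
    (1# ⇒ₙ x) ⇒ₙ ((1# ⇒ y) ⇒ₙ (x ⇒ y))
      ≈⟨ ⇒ₙ-cong refl (1⇒ₙx≈x _) ⟨
    (1# ⇒ₙ x) ⇒ₙ (1# ⇒ₙ ((1# ⇒ y) ⇒ₙ (x ⇒ y)))
      ≈⟨ ⇒ₙ-cong refl (⇒ₙ-cong (≤⇒⊑ (maximum x)) refl) ⟨
    (1# ⇒ₙ x) ⇒ₙ ((x ⇒ₙ 1#) ⇒ₙ ((1# ⇒ y) ⇒ₙ (x ⇒ y)))
      ≈⟨ SN8 1# x y ⟩
    1# ∎)
    where open ≈R

  ⇒-relativeˡ : ∀ {u x y z} → u ∧ x ⊑ y → u ∧ y ⊑ x → u ∧ (x ⇒ z) ⊑ (y ⇒ z)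
  ⇒-relativeˡ {u} {x} {y} {z} p q =
    ⊑-trans (⊑-∧-greatest
      (⊑-∧-greatest (⊑-trans (≤⇒⊑ (x∧y≤x _ _)) (⊑-curry p))
                    (⊑-trans (≤⇒⊑ (x∧y≤x _ _)) (⊑-curry q)))
      (≤⇒⊑ (x∧y≤y _ _)))
      (⊑-uncurry (⊑-uncurry (SN8 x y z)))

  ⇒-relativeʳ : ∀ {u x y z} → u ∧ x ⊑ y → u ∧ y ⊑ x → u ∧ (z ⇒ x) ⊑ (z ⇒ y)
  ⇒-relativeʳ {u} {x} {y} {z} p q =
    ⊑-trans (⊑-∧-greatest
      (⊑-∧-greatest (⊑-trans (≤⇒⊑ (x∧y≤x _ _)) (⊑-curry p))
                    (⊑-trans (≤⇒⊑ (x∧y≤x _ _)) (⊑-curry q)))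
      (≤⇒⊑ (x∧y≤y _ _)))
      (⊑-uncurry (⊑-uncurry (SN9 x y z)))

module _ {c ℓ} (A : SemiNelsonAlgebra c ℓ) where
  open SemiNelsonAlgebra A
  open SemiNelsonProperties A

  infix 4 _≋_
  _≋_ : Rel Carrier ℓ
  x ≋ y = (x ⇒ y) ≈ 1# × (y ⇒ x) ≈ 1#

  private
    ≋⇒⊑ : ∀ {x y} → x ≋ y → x ⊑ y
    ≋⇒⊑ (p , _) = ⊑-trans (≤⇒⊑ (∧-greatest ≤-refl (≤-trans (maximum _) (reflexive (sym p))))) ∧-⇒-⊑

    ≋⇒⊒ : ∀ {x y} → x ≋ y → y ⊑ x
    ≋⇒⊒ (p , q) = ≋⇒⊑ (q , p)

    ⊑-antisym-⇒ : ∀ {x y} → x ⊑ y → y ⊑ x → (x ⇒ y) ≈ 1#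
    ⊑-antisym-⇒ {x} {y} p q = 1⊑⇒≈1 (⊑-trans
      (≤⇒⊑ (∧-greatest ≤-refl (reflexive (sym (x⇒x≈1 x)))))
      (⇒-relativeʳ (⊑-trans (≤⇒⊑ (x∧y≤y _ _)) p) (⊑-trans (≤⇒⊑ (x∧y≤y _ _)) q)))

    ⊑-antisym : ∀ {x y} → x ⊑ y → y ⊑ x → x ≋ y
    ⊑-antisym p q = ⊑-antisym-⇒ p q , ⊑-antisym-⇒ q p

  ≈⇒≋ : ∀ {x y} → x ≈ y → x ≋ y
  ≈⇒≋ e = ⊑-antisym (≤⇒⊑ (reflexive e)) (≤⇒⊑ (reflexive (sym e)))

  private
    quotientLattice : Order.BoundedLattice c ℓ ℓ
    quotientLattice = record
      { _≈_ = _≋_ ; _≤_ = _⊑_ ; _∨_ = _∨_ ; _∧_ = _∧_ ; ⊤ = 1# ; ⊥ = 0#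
      ; isBoundedLattice = record
        { isLattice = record
          { isPartialOrder = record
            { isPreorder = record
              { isEquivalence = record
                { refl  = ≈⇒≋ refl
                ; sym   = λ (p , q) → q , p
                ; trans = λ p q → ⊑-antisym (⊑-trans (≋⇒⊑ p) (≋⇒⊑ q))
                                            (⊑-trans (≋⇒⊒ q) (≋⇒⊒ p))
                }
              ; reflexive = ≋⇒⊑
              ; trans     = ⊑-trans
              }
            ; antisym = ⊑-antisym
            }
          ; supremum = λ x y → ≤⇒⊑ (x≤x∨y x y) , ≤⇒⊑ (y≤x∨y x y) , λ z → ⊑-∨-least
          ; infimum  = λ x y → ≤⇒⊑ (x∧y≤x x y) , ≤⇒⊑ (x∧y≤y x y) , λ z → ⊑-∧-greatest
          }
        ; maximum = λ x → ≤⇒⊑ (maximum x)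
        ; minimum = λ x → ≤⇒⊑ (minimum x)
        }
      }

    module Q  = Order.BoundedLattice quotientLattice
    module QJ = BJoinProperties Q.boundedJoinSemilattice
    module QM = BMeetProperties Q.boundedMeetSemilattice

    ⊑-∧ˡ : ∀ {x y z} → y ⊑ z → x ∧ y ⊑ z
    ⊑-∧ˡ = ⊑-trans (≤⇒⊑ (x∧y≤y _ _))

    ≋-⇒-cong : ∀ {x x′ y y′} → x ≋ x′ → y ≋ y′ → (x ⇒ y) ≋ (x′ ⇒ y′)
    ≋-⇒-cong p q = ⊑-antisym (half p q) (half (Q.Eq.sym p) (Q.Eq.sym q))
      where
      half : ∀ {x x′ y y′} → x ≋ x′ → y ≋ y′ → (x ⇒ y) ⊑ (x′ ⇒ y′)
      half p q =
        ⊑-trans (⊑-∧-greatest ⊑-refl ⊑-refl) (⊑-trans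
          (⇒-relativeˡ (⊑-∧ˡ (≋⇒⊑ p)) (⊑-∧ˡ (≋⇒⊒ p)))
          (⊑-trans (⊑-∧-greatest ⊑-refl ⊑-refl)
            (⇒-relativeʳ (⊑-∧ˡ (≋⇒⊑ q)) (⊑-∧ˡ (≋⇒⊒ q)))))

    ≋-∧-⇒ : ∀ x y → x ∧ (x ⇒ y) ≋ x ∧ y
    ≋-∧-⇒ x y = ⊑-antisym
      (⊑-∧-greatest (≤⇒⊑ (x∧y≤x _ _)) ∧-⇒-⊑)
      (⊑-∧-greatest (≤⇒⊑ (x∧y≤x _ _)) ∧-⊑-⇒)

    ≋-∧-⇒-∧ : ∀ x y z → x ∧ (y ⇒ z) ≋ x ∧ (x ∧ y ⇒ x ∧ z)
    ≋-∧-⇒-∧ x y z = ⊑-antisym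
      (⊑-∧-greatest (≤⇒⊑ (x∧y≤x _ _))
        (⊑-trans (⊑-∧-greatest (≤⇒⊑ (x∧y≤x _ _)) (⇒-relativeˡ ⊑-refl drop))
          (⇒-relativeʳ ⊑-refl drop)))
      (⊑-∧-greatest (≤⇒⊑ (x∧y≤x _ _))
        (⊑-trans (⊑-∧-greatest (≤⇒⊑ (x∧y≤x _ _)) (⇒-relativeˡ drop ⊑-refl))
          (⇒-relativeʳ drop ⊑-refl)))
      where
      drop : ∀ {y} → x ∧ (x ∧ y) ⊑ y
      drop = ⊑-∧ˡ (≤⇒⊑ (x∧y≤y _ _))

  sH : SemiHeytingAlgebra c ℓ
  sH = record
    { Carrier = Carrier
    ; _≈_ = _≋_
    ; _∧_ = _∧_
    ; _∨_ = _∨_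
    ; _⇒_ = _⇒_
    ; 0#  = ∼ 1#
    ; 1#  = 1#
    ; isLattice  = LatticeProperties.isAlgLattice Q.lattice
    ; ∨-identity = QJ.identity
    ; ∧-identity = QM.identity
    ; ⇒-cong     = ≋-⇒-cong
    ; ∧-⇒        = ≋-∧-⇒
    ; ∧-⇒-∧      = ≋-∧-⇒-∧
    ; x⇒x≈1      = λ x → ≈⇒≋ (x⇒x≈1 x)
    }

  -- the class of x meets A⁺
  PositiveClass : Pred Carrier (c ⊔ ℓ)
  PositiveClass x = ∃ λ a → Positive a × a ≋ x

  private
    ≤⇒⊑-sH : ∀ {x y} → SemiHeytingAlgebra._≤_ sH x y → x ⊑ y
    ≤⇒⊑-sH x≤y = ⊑-trans (≋⇒⊑ x≤y) (≤⇒⊑ (x∧y≤y _ _))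

    positive-upward : ∀ {a b} → a ≤ b → Positive a → Positive b
    positive-upward a≤b pos = ≤-trans (∼-antitone a≤b) (≤-trans pos a≤b)

    class-upward : ∀ {a y} → Positive a → a ⊑ y → PositiveClass y
    class-upward {a} {y} pos a⊑y =
      a ∨ y , positive-upward (x≤x∨y a y) pos ,
      ⊑-antisym (⊑-∨-least a⊑y ⊑-refl) (≤⇒⊑ (y≤x∨y a y))

    y∨∼y-positive : ∀ y → Positive (y ∨ ∼ y)
    y∨∼y-positive y = ≤-trans (reflexive (∼-∨ y (∼ y)))
                              (≤-trans (x∧y≤x _ _) (y≤x∨y y (∼ y)))

    ∧-positive : ∀ {a b} → Positive a → Positive b → Positive (a ∧ b)
    ∧-positive {a} {b} pa pb = ≤-trans (reflexive (SN4 a b))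
      (∨-least (∧-greatest pa (below pa pb)) (∧-greatest (below pb pa) pb))
      where
      below : ∀ {a b} → Positive a → Positive b → ∼ a ≤ b
      below {a} {b} pa pb = ≤-trans (∧-greatest pa ≤-refl)
        (≤-trans (kleene a b) (∨-least ≤-refl pb))

    ∼-positive⊑0 : ∀ {p} → Positive p → ∼ p ⊑ 0#
    ∼-positive⊑0 {p} pos =
      ≤⇒⊑′ (≤-trans pos (≤-trans (reflexive (sym (SN3 p))) (x≤x∨y _ _)))

    ∼[x⇒0]⊑x : ∀ x → ∼ (x ⇒ 0#) ⊑ x
    ∼[x⇒0]⊑x x = ⊑-trans (SN10 x 0#) (≤⇒⊑ (x∧y≤x _ _))

    x⊑∼[x⇒0] : ∀ x → x ⊑ ∼ (x ⇒ 0#)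
    x⊑∼[x⇒0] x = ⊑-trans
      (≤⇒⊑ (∧-greatest ≤-refl (≤-trans (maximum x) (reflexive (sym (SN3 1#))))))
      (SN11 x 0#)

    positive-dense : ∀ {x} → (x ⇒ 0#) ⊑ 0# → PositiveClass x
    positive-dense {x} dense = class-upward pos (∼[x⇒0]⊑x x)
      where
      pos : Positive (∼ (x ⇒ 0#))
      pos = ≤-trans (reflexive (SN3 _))
        (≤-trans (⊑⇒≤ dense) (∨-least ≤-refl (minimum _)))

    positive-⇒-closed : ∀ {z t} → PositiveClass (z ∨ t) →
                        ∀ x → PositiveClass ((x ⇒ z) ∨ (x ∧ t))
    positive-⇒-closed {z} {t} (p , pos , p≋z∨t) x =
      class-upward (y∨∼y-positive y)
        (⊑-∨-least (⊑-trans y⊑ (≤⇒⊑ (x≤x∨y _ _))) (⊑-trans ∼y⊑ (≤⇒⊑ (y≤x∨y _ _))))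
      where
      -- w ≋ z, and ∼ w lies in the class of z * ∧ (z ∨ t)
      w = ∼ (z ⇒ 0#) ∨ ∼ p
      y = x ⇒ w

      w≋z : w ≋ z
      w≋z = ⊑-antisym
        (⊑-∨-least (∼[x⇒0]⊑x z) (⊑-trans (∼-positive⊑0 pos) (≤⇒⊑ (minimum z))))
        (⊑-trans (x⊑∼[x⇒0] z) (≤⇒⊑ (x≤x∨y _ _)))

      y⊑ : y ⊑ (x ⇒ z)
      y⊑ = ≋⇒⊑ (≋-⇒-cong (≈⇒≋ refl) w≋z)

      ∼w≤ : ∼ w ≤ (z ⇒ 0#) ∧ p
      ∼w≤ = reflexive (trans (∼-∨ _ _) (∧-cong (SN3 _) (SN3 p)))

      ∼w⊑t : ∼ w ⊑ t
      ∼w⊑t = ⊑-trans (≤⇒⊑ ∼w≤) (⊑-trans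
        (⊑-∧-greatest (≤⇒⊑ (x∧y≤x _ _)) (⊑-∧ˡ (≋⇒⊑ p≋z∨t)))
        (⊑-trans (≤⇒⊑ (reflexive (∧-distrib _ z t)))
          (⊑-∨-least
            (⊑-trans (≤⇒⊑ (reflexive (∧-comm _ z))) (⊑-trans ∧-⇒-⊑ (≤⇒⊑ (minimum t))))
            (≤⇒⊑ (x∧y≤y _ t)))))

      ∼y⊑ : ∼ y ⊑ x ∧ t
      ∼y⊑ = ⊑-trans (SN10 x w) (⊑-∧-greatest (≤⇒⊑ (x∧y≤x _ _)) (⊑-∧ˡ ∼w⊑t))

  positiveClass-isIFilter : IsIFilter sH PositiveClass
  positiveClass-isIFilter = record
    { isLatticeFilter = record
      { resp     = λ x≋y (a , pos , a≋x) → a , pos , Q.Eq.trans a≋x x≋y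
      ; nonempty = 1# , 1# , maximum _ , ≈⇒≋ refl
      ; upward   = λ x≤y (a , pos , a≋x) →
                     class-upward pos (⊑-trans (≋⇒⊑ a≋x) (≤⇒⊑-sH x≤y))
      ; ∧-closed = λ (a , pa , a≋x) (b , pb , b≋y) →
                     a ∧ b , ∧-positive pa pb , SemiHeytingAlgebra.∧-cong sH a≋x b≋y
      }
    ; dense    = λ x*≋0 → positive-dense (≋⇒⊑ x*≋0)
    ; ⇒-closed = positive-⇒-closed
    }

record Category o h e : Set (suc (o ⊔ h ⊔ e)) where
  no-eta-equality
  constructor mkCategory
  infix  4 _≈_
  infixr 9 _∘ᶜ_
  field
    Obj  : Set o
    Hom  : Rel Obj h
    _≈_  : ∀ {X Y} → Rel (Hom X Y) e
    idᶜ  : ∀ {X} → Hom X X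
    _∘ᶜ_ : ∀ {X Y Z} → Hom Y Z → Hom X Y → Hom X Z

    isEquivalence : ∀ {X Y} → IsEquivalence (_≈_ {X} {Y})
    ∘-resp-≈  : ∀ {X Y Z} {f f′ : Hom Y Z} {g g′ : Hom X Y} →
                f ≈ f′ → g ≈ g′ → f ∘ᶜ g ≈ f′ ∘ᶜ g′
    assoc     : ∀ {W X Y Z} {f : Hom Y Z} {g : Hom X Y} {h : Hom W X} →
                (f ∘ᶜ g) ∘ᶜ h ≈ f ∘ᶜ (g ∘ᶜ h)
    identityˡ : ∀ {X Y} {f : Hom X Y} → idᶜ ∘ᶜ f ≈ f
    identityʳ : ∀ {X Y} {f : Hom X Y} → f ∘ᶜ idᶜ ≈ f

{-# INLINE mkCategory #-}

record Functor {o h e o′ h′ e′} (C : Category o h e) (D : Category o′ h′ e′)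
       : Set (o ⊔ h ⊔ e ⊔ o′ ⊔ h′ ⊔ e′) where
  no-eta-equality
  constructor mkFunctor
  private
    module C = Category C
    module D = Category D
  field
    F₀           : C.Obj → D.Obj
    F₁           : ∀ {X Y} → C.Hom X Y → D.Hom (F₀ X) (F₀ Y)
    F-resp-≈     : ∀ {X Y} {f g : C.Hom X Y} → f C.≈ g → F₁ f D.≈ F₁ g
    identity     : ∀ {X} → F₁ (C.idᶜ {X}) D.≈ D.idᶜ
    homomorphism : ∀ {X Y Z} {f : C.Hom X Y} {g : C.Hom Y Z} →
                   F₁ (g C.∘ᶜ f) D.≈ F₁ g D.∘ᶜ F₁ f

{-# INLINE mkFunctor #-}

idF : ∀ {o h e} {C : Category o h e} → Functor C C
idF {C = C} = record
  { F₀ = id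
  ; F₁ = id
  ; F-resp-≈ = id
  ; identity = IsEquivalence.refl (Category.isEquivalence C)
  ; homomorphism = IsEquivalence.refl (Category.isEquivalence C)
  }

infixr 9 _∘F_
_∘F_ : ∀ {o h e o′ h′ e′ o″ h″ e″}
       {C : Category o h e} {D : Category o′ h′ e′} {E : Category o″ h″ e″} →
       Functor D E → Functor C D → Functor C E
_∘F_ {E = E} G F = record
  { F₀ = G.F₀ ∘ F.F₀
  ; F₁ = G.F₁ ∘ F.F₁
  ; F-resp-≈ = G.F-resp-≈ ∘ F.F-resp-≈
  ; identity = trans (G.F-resp-≈ F.identity) G.identity
  ; homomorphism = trans (G.F-resp-≈ F.homomorphism) G.homomorphism
  }
  where
  module F = Functor F
  module G = Functor G
  trans : ∀ {X Y} {f g h : Category.Hom E X Y} → Category._≈_ E f g →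
          Category._≈_ E g h → Category._≈_ E f h
  trans = IsEquivalence.trans (Category.isEquivalence E)

record NaturalIsomorphism {o h e o′ h′ e′}
       {C : Category o h e} {D : Category o′ h′ e′} (F G : Functor C D)
       : Set (o ⊔ h ⊔ e ⊔ o′ ⊔ h′ ⊔ e′) where
  private
    module C = Category C
    module F = Functor F
    module G = Functor G
  open Category D
  field
    η       : ∀ X → Hom (F.F₀ X) (G.F₀ X)
    η⁻¹     : ∀ X → Hom (G.F₀ X) (F.F₀ X)
    natural : ∀ {X Y} (f : C.Hom X Y) → η Y ∘ᶜ F.F₁ f ≈ G.F₁ f ∘ᶜ η X
    isoˡ    : ∀ X → η⁻¹ X ∘ᶜ η X ≈ idᶜ
    isoʳ    : ∀ X → η X ∘ᶜ η⁻¹ X ≈ idᶜ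

record SemiHeytingWithFilter c ℓ p : Set (suc (c ⊔ ℓ ⊔ p)) where
  no-eta-equality
  constructor mkSemiHeytingWithFilter
  field
    H         : SemiHeytingAlgebra c ℓ
    F         : Pred (SemiHeytingAlgebra.Carrier H) p
    isIFilter : IsIFilter H F

{-# INLINE mkSemiHeytingWithFilter #-}

record FilterHomomorphism {c ℓ p} (X Y : SemiHeytingWithFilter c ℓ p)
       : Set (c ⊔ ℓ ⊔ p) where
  no-eta-equality
  constructor mkFilterHomomorphism
  private
    module X = SemiHeytingWithFilter X
    module Y = SemiHeytingWithFilter Y
  field
    homomorphism : SemiHeytingHomomorphism X.H Y.H
  open SemiHeytingHomomorphism homomorphism public
  field
    preserves : ∀ {x} → x ∈ X.F → ⟦ x ⟧ ∈ Y.F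

{-# INLINE mkFilterHomomorphism #-}

idSHF : ∀ {c ℓ p} {X : SemiHeytingWithFilter c ℓ p} → FilterHomomorphism X X
idSHF {X = X} = record
  { homomorphism = record
    { ⟦_⟧ = id ; cong = id
    ; ∧-homo = λ _ _ → refl ; ∨-homo = λ _ _ → refl ; ⇒-homo = λ _ _ → refl
    ; 0-homo = refl ; 1-homo = refl
    }
  ; preserves = id
  }
  where open SemiHeytingAlgebra (SemiHeytingWithFilter.H X) using (refl)

_∘SHF_ : ∀ {c ℓ p} {X Y Z : SemiHeytingWithFilter c ℓ p} →
         FilterHomomorphism Y Z → FilterHomomorphism X Y → FilterHomomorphism X Z
_∘SHF_ {Z = Z} g f = record
  { homomorphism = record
    { ⟦_⟧    = g.⟦_⟧ ∘ f.⟦_⟧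
    ; cong   = g.cong ∘ f.cong
    ; ∧-homo = λ x y → trans (g.cong (f.∧-homo x y)) (g.∧-homo _ _)
    ; ∨-homo = λ x y → trans (g.cong (f.∨-homo x y)) (g.∨-homo _ _)
    ; ⇒-homo = λ x y → trans (g.cong (f.⇒-homo x y)) (g.⇒-homo _ _)
    ; 0-homo = trans (g.cong f.0-homo) g.0-homo
    ; 1-homo = trans (g.cong f.1-homo) g.1-homo
    }
  ; preserves = g.preserves ∘ f.preserves
  }
  where
  open SemiHeytingAlgebra (SemiHeytingWithFilter.H Z) using (trans)
  module f = FilterHomomorphism f
  module g = FilterHomomorphism g

sHF : ∀ c ℓ p → Category (suc (c ⊔ ℓ ⊔ p)) (c ⊔ ℓ ⊔ p) (c ⊔ ℓ)
sHF c ℓ p = record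
  { Obj  = SemiHeytingWithFilter c ℓ p
  ; Hom  = FilterHomomorphism
  ; _≈_  = λ {_} {Y} f g → ∀ x → Eq._≈_ Y (⟦ f ⟧ x) (⟦ g ⟧ x)
  ; idᶜ  = idSHF
  ; _∘ᶜ_ = _∘SHF_
  ; isEquivalence = λ {_} {Y} → record
    { refl  = λ _ → Eq.refl Y
    ; sym   = λ p x → Eq.sym Y (p x)
    ; trans = λ p q x → Eq.trans Y (p x) (q x)
    }
  ; ∘-resp-≈  = λ {_} {_} {Z} {f} {_} {_} {g′} p q x →
                  Eq.trans Z (cong f (q x)) (p (⟦ g′ ⟧ x))
  ; assoc     = λ {_} {_} {_} {Z} _ → Eq.refl Z
  ; identityˡ = λ {_} {Y} _ → Eq.refl Y
  ; identityʳ = λ {_} {Y} _ → Eq.refl Y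
  }
  where
  open FilterHomomorphism using (⟦_⟧; cong)
  module Eq (X : SemiHeytingWithFilter c ℓ p) =
    SemiHeytingAlgebra (SemiHeytingWithFilter.H X) using (_≈_; refl; sym; trans)

idSN : ∀ {c ℓ} {A : SemiNelsonAlgebra c ℓ} → SemiNelsonHomomorphism A A
idSN {A = A} = record
  { ⟦_⟧ = id ; cong = id
  ; ∧-homo = λ _ _ → refl ; ∨-homo = λ _ _ → refl ; ⇒-homo = λ _ _ → refl
  ; ∼-homo = λ _ → refl ; 1-homo = refl
  }
  where open SemiNelsonAlgebra A using (refl)

_∘SN_ : ∀ {c ℓ} {A B C : SemiNelsonAlgebra c ℓ} →
        SemiNelsonHomomorphism B C → SemiNelsonHomomorphism A B →
        SemiNelsonHomomorphism A C
_∘SN_ {C = C} g f = record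
  { ⟦_⟧    = g.⟦_⟧ ∘ f.⟦_⟧
  ; cong   = g.cong ∘ f.cong
  ; ∧-homo = λ x y → trans (g.cong (f.∧-homo x y)) (g.∧-homo _ _)
  ; ∨-homo = λ x y → trans (g.cong (f.∨-homo x y)) (g.∨-homo _ _)
  ; ⇒-homo = λ x y → trans (g.cong (f.⇒-homo x y)) (g.⇒-homo _ _)
  ; ∼-homo = λ x → trans (g.cong (f.∼-homo x)) (g.∼-homo _)
  ; 1-homo = trans (g.cong f.1-homo) g.1-homo
  }
  where
  open SemiNelsonAlgebra C using (trans)
  module f = SemiNelsonHomomorphism f
  module g = SemiNelsonHomomorphism g

sN : ∀ c ℓ → Category (suc (c ⊔ ℓ)) (c ⊔ ℓ) (c ⊔ ℓ)
sN c ℓ = record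
  { Obj  = SemiNelsonAlgebra c ℓ
  ; Hom  = SemiNelsonHomomorphism
  ; _≈_  = λ {_} {B} f g → ∀ x → Eq._≈_ B (⟦ f ⟧ x) (⟦ g ⟧ x)
  ; idᶜ  = idSN
  ; _∘ᶜ_ = _∘SN_
  ; isEquivalence = λ {_} {B} → record
    { refl  = λ _ → Eq.refl B
    ; sym   = λ p x → Eq.sym B (p x)
    ; trans = λ p q x → Eq.trans B (p x) (q x)
    }
  ; ∘-resp-≈  = λ {_} {_} {C} {f} {_} {_} {g′} p q x →
                  Eq.trans C (cong f (q x)) (p (⟦ g′ ⟧ x))
  ; assoc     = λ {_} {_} {_} {D} _ → Eq.refl D
  ; identityˡ = λ {_} {B} _ → Eq.refl B
  ; identityʳ = λ {_} {B} _ → Eq.refl B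
  }
  where
  open SemiNelsonHomomorphism using (⟦_⟧; cong)
  module Eq = SemiNelsonAlgebra using (_≈_; refl; sym; trans)

module _ {c ℓ p} {X Y : SemiHeytingWithFilter c ℓ p} (f : FilterHomomorphism X Y) where
  private
    module X = SemiHeytingWithFilter X
    module Y = SemiHeytingWithFilter Y
    module F = IsIFilter Y.isIFilter
  open SemiHeytingAlgebra Y.H using (refl; sym; trans)
  open FilterHomomorphism f

  α₁ : SemiNelsonHomomorphism (N X.H X.isIFilter) (N Y.H Y.isIFilter)
  α₁ = record
    { ⟦_⟧    = λ (npair a b ab ab∈F) → npair ⟦ a ⟧ ⟦ b ⟧
                 (trans (sym (∧-homo a b)) (trans (cong ab) 0-homo))
                 (F.resp (∨-homo a b) (preserves ab∈F))
    ; cong   = λ (p , q) → cong p , cong q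
    ; ∧-homo = λ _ _ → ∧-homo _ _ , ∨-homo _ _
    ; ∨-homo = λ _ _ → ∨-homo _ _ , ∧-homo _ _
    ; ⇒-homo = λ _ _ → ⇒-homo _ _ , ∧-homo _ _
    ; ∼-homo = λ _ → refl , refl
    ; 1-homo = 1-homo , 0-homo
    }

α : ∀ c ℓ p → Functor (sHF c ℓ p) (sN (c ⊔ ℓ ⊔ p) ℓ)
α c ℓ p = record
  { F₀ = λ X → N (H X) (isIFilter X)
  ; F₁ = α₁
  ; F-resp-≈ = λ f≈g x → f≈g (NPair.fst x) , f≈g (NPair.snd x)
  ; identity = λ {X} _ → refl (H X) , refl (H X)
  ; homomorphism = λ {_} {_} {Z} _ → refl (H Z) , refl (H Z)
  }
  where
  open SemiHeytingWithFilter using (H; isIFilter)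
  open SemiHeytingAlgebra using (refl)

β₀ : ∀ {c ℓ} → SemiNelsonAlgebra c ℓ → SemiHeytingWithFilter c ℓ (c ⊔ ℓ)
β₀ A = record
  { H         = sH A
  ; F         = PositiveClass A
  ; isIFilter = positiveClass-isIFilter A
  }

module _ {c ℓ} {A B : SemiNelsonAlgebra c ℓ} (f : SemiNelsonHomomorphism A B) where
  private
    module A = SemiNelsonAlgebra A
    module B = SemiNelsonAlgebra B
    module Q = SemiHeytingAlgebra (sH B)
  open SemiNelsonHomomorphism f

  private
    cong-≋ : ∀ {x y} → _≋_ A x y → _≋_ B ⟦ x ⟧ ⟦ y ⟧
    cong-≋ (p , q) = B.trans (B.sym (⇒-homo _ _)) (B.trans (cong p) 1-homo) ,
                     B.trans (B.sym (⇒-homo _ _)) (B.trans (cong q) 1-homo)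

    cong-positive : ∀ {a} → A.Positive a → B.Positive ⟦ a ⟧
    cong-positive {a} pos =
      B.trans (B.sym (∼-homo a)) (B.trans (cong pos)
        (B.trans (∧-homo _ _) (B.∧-cong (∼-homo a) B.refl)))

  β₁ : FilterHomomorphism (β₀ A) (β₀ B)
  β₁ = record
    { homomorphism = record
      { ⟦_⟧    = ⟦_⟧
      ; cong   = cong-≋
      ; ∧-homo = λ x y → ≈⇒≋ B (∧-homo x y)
      ; ∨-homo = λ x y → ≈⇒≋ B (∨-homo x y)
      ; ⇒-homo = λ x y → ≈⇒≋ B (⇒-homo x y)
      ; 0-homo = ≈⇒≋ B (B.trans (∼-homo A.1#) (B.∼-cong 1-homo))
      ; 1-homo = ≈⇒≋ B 1-homo
      }
    ; preserves = λ (a , pos , a≋x) → ⟦ a ⟧ , cong-positive pos , cong-≋ a≋x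
    }

β : ∀ c ℓ → Functor (sN c ℓ) (sHF c ℓ (c ⊔ ℓ))
β c ℓ = record
  { F₀ = β₀
  ; F₁ = β₁
  ; F-resp-≈ = λ {_} {B} f≈g x → ≈⇒≋ B (f≈g x)
  ; identity = λ {A} _ → SemiHeytingAlgebra.refl (sH A)
  ; homomorphism = λ {_} {_} {C} _ → SemiHeytingAlgebra.refl (sH C)
  }

{-# OPTIONS --safe #-}

-- An element of βα(H,F) is determined by its first component, so the component
-- of the isomorphism at (H,F) is the first projection; its inverse sends x to
-- (x , x *), because x ∨ x * is dense.
--
-- In the other direction a ↦ (a , ∼ a) embeds A into αβ(A). A pair (a , b) of
-- classes with a ∧ b ≋ 0 and a ∨ b ≋ p, p positive, is the image of
-- ∼ (a ⇒ 0) ∨ ∼ p: the class of ∼ p is 0, so this lies in the class of a,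
-- and its negation (a ⇒ 0) ∧ p lies in the class of a * ∧ (a ∨ b), that is, b.

module Submission where

open import Defs
open import Level using (Level)
open import Data.Product using (_×_; _,_; proj₁; proj₂)
open import Relation.Binary.Core using (Rel)
open import Relation.Unary using (Pred; _∈_)
import Relation.Binary.Reasoning.PartialOrder as ≤-Reasoning

-- Pseudocomplements in a semi-Heyting algebra.

module PseudocomplementProperties {c ℓ} (H : SemiHeytingAlgebra c ℓ) where
  open SemiHeytingAlgebra H
  open SemiHeytingProperties H

  ∧-* : ∀ x → x ∧ x * ≈ 0#
  ∧-* x = trans (∧-⇒ x 0#) (≤0⇒≈0 (x∧y≤y x 0#))

  ≤-* : ∀ {x y} → x ∧ y ≤ 0# → x ≤ y *
  ≤-* {x} {y} xy≤0 =
    -- The Heyting implication `y ⇨ 0#` is `y ⇒ y ∧ 0#`, which is `y *`.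
    ≤-trans (transpose xy≤0) (reflexive (⇒-cong refl (≤0⇒≈0 (x∧y≤y y 0#))))

  -- The pseudocomplement of `x ∨ x *` lies below both `x *` and `x * *`, which are disjoint.
  ∨-*-dense : ∀ x → Dense (x ∨ x *)
  ∨-*-dense x = ≤0⇒≈0 (≤-trans
    (∧-greatest ≤-refl (≤-* (below (y≤x∨y x (x *)))))
    (≤-trans (∧-monotonic (≤-* (below (x≤x∨y x (x *)))) ≤-refl)
             (reflexive (∧-* (x *)))))
    where
    below : ∀ {y} → y ≤ x ∨ x * → (x ∨ x *) * ∧ y ≤ 0#
    below y≤ = ≤-trans (∧-monotonic ≤-refl y≤)
      (reflexive (trans (∧-comm _ _) (∧-* _)))

  ⇒≈1⇒≤ : ∀ {x y} → (x ⇒ y) ≈ 1# → x ≤ y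
  ⇒≈1⇒≤ {x} {y} x⇒y≈1 =
    trans (sym (proj₂ ∧-identity x)) (trans (∧-cong refl (sym x⇒y≈1)) (∧-⇒ x y))

-- Classes and positive elements of the pair algebra.

module _ {c ℓ p} (H : SemiHeytingAlgebra c ℓ)
         {F : Pred (SemiHeytingAlgebra.Carrier H) p} (F-isIFilter : IsIFilter H F) where
  open SemiHeytingAlgebra H
  open SemiHeytingProperties H
  open PseudocomplementProperties H
  open IsIFilter F-isIFilter using (resp; dense)
  open NPair

  private
    infix 4 _≋ₙ_
    _≋ₙ_ : Rel (NPair H F-isIFilter) ℓ
    _≋ₙ_ = _≋_ (N H F-isIFilter)

  ≋ₙ⇒fst≈ : ∀ x y → x ≋ₙ y → fst x ≈ fst y
  ≋ₙ⇒fst≈ _ _ ((a⇒c≈1 , _) , (c⇒a≈1 , _)) = antisym (⇒≈1⇒≤ a⇒c≈1) (⇒≈1⇒≤ c⇒a≈1)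

  -- The second component of `x ⟶ y` is `fst x ∧ snd y`, which vanishes once `fst x ≈ fst y` because
  -- `y` is a disjoint pair.
  fst≈⇒≋ₙ : ∀ x y → fst x ≈ fst y → x ≋ₙ y
  fst≈⇒≋ₙ x y a≈c =
    (trans (⇒-cong a≈c refl) (x⇒x≈1 _) , trans (∧-cong a≈c refl) (disjoint y)) ,
    (trans (⇒-cong (sym a≈c) refl) (x⇒x≈1 _) ,
     trans (∧-cong (sym a≈c) refl) (disjoint x))

  _,* : Carrier → NPair H F-isIFilter
  x ,* = npair x (x *) (∧-* x) (dense (∨-*-dense x))

  -- A pair `(a , b)` is positive only if `b ≤ a`; then `a ∨ b ∈ F` already says `a ∈ F`.
  positiveClass⇒fst∈F : ∀ x → x ∈ PositiveClass (N H F-isIFilter) → fst x ∈ F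
  positiveClass⇒fst∈F x (q@(npair a b ab≈0 a∨b∈F) , (b≤a , _) , q≋x) =
    resp (≋ₙ⇒fst≈ q x q≋x) (resp a∨b≈a a∨b∈F)
    where
    a∨b≈a : a ∨ b ≈ a
    a∨b≈a = antisym (∨-least ≤-refl b≤a) (x≤x∨y a b)

  ∈F⇒positiveClass : ∀ {x} → x ∈ F → (x ,*) ∈ PositiveClass (N H F-isIFilter)
  ∈F⇒positiveClass {x} x∈F =
    -- `(x , x *)` need not be positive itself; `(x , 0#)` is, and has the same class.
    q , (minimum x , sym (proj₂ ∨-identity x)) , fst≈⇒≋ₙ q (x ,*) refl
    where
    q : NPair H F-isIFilter
    q = npair x 0# (≤0⇒≈0 (x∧y≤y x 0#)) (resp (sym (proj₂ ∨-identity x)) x∈F)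

-- Inverting a bijective homomorphism.

module _ {c ℓ c′ ℓ′} {A : SemiNelsonAlgebra c ℓ} {B : SemiNelsonAlgebra c′ ℓ′}
         (f : SemiNelsonHomomorphism A B) where
  private
    module A = SemiNelsonAlgebra A
    module B = SemiNelsonAlgebra B
  open SemiNelsonHomomorphism f

  -- Injectivity turns each law of `f` into one for `g`, and even makes `g` respect equality, which
  -- is not assumed.
  inverseHomomorphism :
    (g : B.Carrier → A.Carrier) →
    (∀ {x y} → ⟦ x ⟧ B.≈ ⟦ y ⟧ → x A.≈ y) → (∀ y → ⟦ g y ⟧ B.≈ y) →
    SemiNelsonHomomorphism B A
  inverseHomomorphism g injective fg≈id = record
    { ⟦_⟧    = g
    ; cong   = λ x≈y → lift (B.trans x≈y (B.sym (fg≈id _)))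
    ; ∧-homo = λ x y → lift (B.sym
        (B.trans (∧-homo _ _) (B.∧-cong (fg≈id x) (fg≈id y))))
    ; ∨-homo = λ x y → lift (B.sym
        (B.trans (∨-homo _ _) (B.∨-cong (fg≈id x) (fg≈id y))))
    ; ⇒-homo = λ x y → lift (B.sym
        (B.trans (⇒-homo _ _) (B.⇒-cong (fg≈id x) (fg≈id y))))
    ; ∼-homo = λ x → lift (B.sym (B.trans (∼-homo _) (B.∼-cong (fg≈id x))))
    ; 1-homo = lift (B.sym 1-homo)
    }
    where
    lift : ∀ {y x} → y B.≈ ⟦ x ⟧ → g y A.≈ x
    lift y≈fx = injective (B.trans (fg≈id _) y≈fx)

-- The isomorphism between a semi-Nelson algebra and its algebra of pairs.

module _ {c ℓ} (A : SemiNelsonAlgebra c ℓ) where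
  open SemiNelsonAlgebra A
  open SemiNelsonProperties A
  open NPair
  private
    module Q = SemiHeytingAlgebra (sH A)

    infix 4 _≈A_
    _≈A_ : Rel Carrier ℓ
    _≈A_ = _≋_ A

  ≋⇒⊑ : ∀ {x y} → x ≈A y → x ⊑ y
  ≋⇒⊑ (x⇒y≈1 , _) = ⊑-trans
    (≤⇒⊑ (∧-greatest ≤-refl (≤-trans (maximum _) (reflexive (sym x⇒y≈1))))) ∧-⇒-⊑

  -- In `x ⇒ x ≈ 1#` the consequent may be replaced by the equivalent `y`; this is SN9.
  ⊑-antisym : ∀ {x y} → x ⊑ y → y ⊑ x → x ≈A y
  ⊑-antisym p q = ⇒≈1 p q , ⇒≈1 q p
    where
    ⇒≈1 : ∀ {x y} → x ⊑ y → y ⊑ x → (x ⇒ y) ≈ 1#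
    ⇒≈1 {x} p q = 1⊑⇒≈1 (⊑-trans
      (≤⇒⊑ (∧-greatest ≤-refl (reflexive (sym (x⇒x≈1 x)))))
      (⇒-relativeʳ (⊑-trans (≤⇒⊑ (x∧y≤y _ _)) p) (⊑-trans (≤⇒⊑ (x∧y≤y _ _)) q)))

  -- By `x ⊑ y` it suffices to bound `x ∧ ∼ x`. The Kleene law splits this into parts below `x ∧ y`
  -- and `x ∧ ∼ y`; the contraposed hypothesis bounds the latter.
  ⊑-contraposed⇒≤ : ∀ {x y} → x ⊑ y → ∼ y ⊑ ∼ x → x ≤ y
  ⊑-contraposed⇒≤ {x} {y} x⊑y ∼y⊑∼x = begin
    x                  ≤⟨ ∧-greatest ≤-refl (⊑⇒≤ x⊑y) ⟩
    x ∧ (∼ x ∨ y)      ≈⟨ ∧-distrib x (∼ x) y ⟩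
    x ∧ ∼ x ∨ x ∧ y    ≤⟨ ∨-least x∧∼x≤y (x∧y≤y x y) ⟩
    y                  ∎
    where
    open ≤-Reasoning poset

    x∧∼y≤y : x ∧ ∼ y ≤ y
    x∧∼y≤y = begin
      x ∧ ∼ y          ≈⟨ ∧-comm _ _ ⟩
      ∼ y ∧ x          ≈⟨ ∧-cong refl (SN3 x) ⟨
      ∼ y ∧ ∼ ∼ x      ≈⟨ ∼-∨ y (∼ x) ⟨
      -- This negates `∼ y ≤ y ∨ ∼ x`, the meaning of `∼ y ⊑ ∼ x`.
      ∼ (y ∨ ∼ x)      ≤⟨ ∼-antitone (≤-trans (⊑⇒≤ ∼y⊑∼x)
                            (∨-monotonic (reflexive (SN3 y)) ≤-refl)) ⟩
      ∼ ∼ y            ≈⟨ SN3 y ⟩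
      y                ∎

    x∧∼x≤y : x ∧ ∼ x ≤ y
    x∧∼x≤y = begin
      x ∧ ∼ x          ≤⟨ ∧-greatest (x∧y≤x _ _) (kleene x y) ⟩
      x ∧ (y ∨ ∼ y)    ≈⟨ ∧-distrib x y (∼ y) ⟩
      x ∧ y ∨ x ∧ ∼ y  ≤⟨ ∨-least (x∧y≤y _ _) x∧∼y≤y ⟩
      y                ∎

  -- This is the injectivity of `embedding`.
  ≋-∼-≋⇒≈ : ∀ {x y} → x ≈A y → ∼ x ≈A ∼ y → x ≈ y
  ≋-∼-≋⇒≈ x≋y ∼x≋∼y = antisym
    (⊑-contraposed⇒≤ (≋⇒⊑ x≋y) (≋⇒⊑ (Q.sym ∼x≋∼y)))
    (⊑-contraposed⇒≤ (≋⇒⊑ (Q.sym x≋y)) (≋⇒⊑ ∼x≋∼y))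

  -- An element below its own negation has class zero, and `x ∧ ∼ x ≤ ∼ x ≤ ∼ (x ∧ ∼ x)`.
  x∧∼x≋0 : ∀ x → x ∧ ∼ x ≈A 0#
  x∧∼x≋0 x = ⊑-antisym
    (≤⇒⊑′ (≤-trans (kleene x (x ∧ ∼ x)) (∨-least below (x≤x∨y _ _))))
    (≤⇒⊑ (minimum _))
    where
    below : x ∧ ∼ x ≤ ∼ (x ∧ ∼ x) ∨ 0#
    below = ≤-trans (x∧y≤y x (∼ x))
      (≤-trans (∼-antitone (x∧y≤x x (∼ x))) (x≤x∨y _ _))

  x∨∼x-positive : ∀ x → Positive (x ∨ ∼ x)
  x∨∼x-positive x =
    ≤-trans (reflexive (∼-∨ x (∼ x))) (≤-trans (x∧y≤x _ _) (y≤x∨y x (∼ x)))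

  embedding : SemiNelsonHomomorphism A (N (sH A) (positiveClass-isIFilter A))
  embedding = record
    { ⟦_⟧    = λ x → npair x (∼ x) (x∧∼x≋0 x) (x ∨ ∼ x , x∨∼x-positive x , Q.refl)
    ; cong   = λ x≈y → ≈⇒≋ A x≈y , ≈⇒≋ A (∼-cong x≈y)
    ; ∧-homo = λ x y → Q.refl , ≈⇒≋ A (SN4 x y)
    ; ∨-homo = λ x y → Q.refl , ≈⇒≋ A (∼-∨ x y)
    ; ⇒-homo = λ x y → Q.refl , ⊑-antisym (SN10 x y) (SN11 x y)
    ; ∼-homo = λ x → Q.refl , ≈⇒≋ A (SN3 x)
    ; 1-homo = Q.refl , Q.refl
    }

  representative : NPair (sH A) (positiveClass-isIFilter A) → Carrier
  representative (npair a b _ (p , _)) = ∼ (a ⇒ 0#) ∨ ∼ p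

  representative≋fst : ∀ x → representative x ≈A fst x
  representative≋fst (npair a b _ (p , ∼p≤p , _)) = ⊑-antisym
    (⊑-∨-least (⊑-trans (SN10 a 0#) (≤⇒⊑ (x∧y≤x _ _)))
               (⊑-trans ∼p⊑0 (≤⇒⊑ (minimum a))))
    (⊑-trans a⊑∼[a⇒0] (≤⇒⊑ (x≤x∨y _ _)))
    where
    ∼p⊑0 : ∼ p ⊑ 0#
    ∼p⊑0 = ≤⇒⊑′ (≤-trans ∼p≤p (≤-trans (reflexive (sym (SN3 p))) (x≤x∨y _ _)))

    a⊑∼[a⇒0] : a ⊑ ∼ (a ⇒ 0#)
    -- Since `∼ 0#` is `1#`, `a` lies below `a ∧ ∼ 0#`, where SN11 applies.
    a⊑∼[a⇒0] = ⊑-trans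
      (≤⇒⊑ (∧-greatest ≤-refl (≤-trans (maximum a) (reflexive (sym (SN3 1#))))))
      (SN11 a 0#)

  ∼representative≋snd : ∀ x → ∼ representative x ≈A snd x
  ∼representative≋snd (npair a b a∧b≋0 (p , _ , p≋a∨b)) =
    Q.trans (≈⇒≋ A (trans (∼-∨ _ _) (∧-cong (SN3 _) (SN3 p))))
      (⊑-antisym a*∧p⊑b (⊑-∧-greatest b⊑a* b⊑p))
    where
    a*∧p⊑b : (a ⇒ 0#) ∧ p ⊑ b
    a*∧p⊑b = ⊑-trans
      (⊑-∧-greatest (≤⇒⊑ (x∧y≤x _ _)) (⊑-trans (≤⇒⊑ (x∧y≤y _ _)) (≋⇒⊑ p≋a∨b)))
      (⊑-trans (≤⇒⊑ (reflexive (∧-distrib _ a b)))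
        (⊑-∨-least
          (⊑-trans (≤⇒⊑ (reflexive (∧-comm _ a))) (⊑-trans ∧-⇒-⊑ (≤⇒⊑ (minimum b))))
          (≤⇒⊑ (x∧y≤y _ b))))

    b∧a⊑0 : b ∧ a ⊑ 0#
    b∧a⊑0 = ⊑-trans (≤⇒⊑ (reflexive (∧-comm b a))) (≋⇒⊑ a∧b≋0)

    b⊑a* : b ⊑ (a ⇒ 0#)
    -- Relative to `b`, `a` and `0#` agree, so `0# ⇒ 0# ≈ 1#` passes to `a ⇒ 0#`.
    b⊑a* = ⊑-trans
      (≤⇒⊑ (∧-greatest ≤-refl (≤-trans (maximum b) (reflexive (sym (x⇒x≈1 0#))))))
      (⇒-relativeˡ (≤⇒⊑ (≤-trans (x∧y≤y _ _) (minimum a))) b∧a⊑0)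

    b⊑p : b ⊑ p
    b⊑p = ⊑-trans (≤⇒⊑ (y≤x∨y a b)) (≋⇒⊑ (Q.sym p≋a∨b))

  -- `representative` uses the `p` stored in the membership proof, which equality of pairs ignores;
  -- injectivity of `embedding` shows the choice harmless.
  retraction : SemiNelsonHomomorphism (N (sH A) (positiveClass-isIFilter A)) A
  retraction = inverseHomomorphism embedding representative
    (λ (p , q) → ≋-∼-≋⇒≈ p q)
    (λ x → representative≋fst x , ∼representative≋snd x)

-- The two natural isomorphisms.

module _ {ℓ : Level} where
  open SemiHeytingWithFilter using (H; isIFilter)

  fstHomomorphism : (X : SemiHeytingWithFilter ℓ ℓ ℓ) →
                    FilterHomomorphism (β₀ (N (H X) (isIFilter X))) X
  fstHomomorphism X = record
    { homomorphism = record
      { ⟦_⟧    = NPair.fst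
      ; cong   = λ {x} {y} → ≋ₙ⇒fst≈ (H X) (isIFilter X) x y
      ; ∧-homo = λ _ _ → refl
      ; ∨-homo = λ _ _ → refl
      ; ⇒-homo = λ _ _ → refl
      ; 0-homo = refl
      ; 1-homo = refl
      }
    ; preserves = λ {x} → positiveClass⇒fst∈F (H X) (isIFilter X) x
    }
    where open SemiHeytingAlgebra (H X) using (refl)

  -- Second components such as `(x ∧ y) *` and `x * ∨ y *` may differ, but a class depends on first
  -- components only.
  ,*-homomorphism : (X : SemiHeytingWithFilter ℓ ℓ ℓ) →
                    FilterHomomorphism X (β₀ (N (H X) (isIFilter X)))
  ,*-homomorphism X = record
    { homomorphism = record
      { ⟦_⟧    = ι
      ; cong   = λ {x} {y} → ≋ₙ (ι x) (ι y)
      ; ∧-homo = λ x y → ≋ₙ (ι (x ∧ y)) (ι x N.∧ ι y) refl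
      ; ∨-homo = λ x y → ≋ₙ (ι (x ∨ y)) (ι x N.∨ ι y) refl
      ; ⇒-homo = λ x y → ≋ₙ (ι (x ⇒ y)) (ι x N.⇒ ι y) refl
      ; 0-homo = ≋ₙ (ι 0#) (N.∼ N.1#) refl
      ; 1-homo = ≋ₙ (ι 1#) N.1# refl
      }
    ; preserves = ∈F⇒positiveClass (H X) (isIFilter X)
    }
    where
    open SemiHeytingAlgebra (H X) using (refl; _∧_; _∨_; _⇒_; 0#; 1#)
    module N = SemiNelsonAlgebra (N (H X) (isIFilter X))
    ι = _,* (H X) (isIFilter X)
    ≋ₙ = fst≈⇒≋ₙ (H X) (isIFilter X)

  βα≅id : NaturalIsomorphism (β ℓ ℓ ∘F α ℓ ℓ ℓ) idF
  βα≅id = record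
    { η       = fstHomomorphism
    ; η⁻¹     = ,*-homomorphism
    ; natural = λ {_} {Y} _ _ → SemiHeytingAlgebra.refl (H Y)
    ; isoˡ    = λ X x → fst≈⇒≋ₙ (H X) (isIFilter X)
                    (_,* (H X) (isIFilter X) (NPair.fst x)) x (SemiHeytingAlgebra.refl (H X))
    ; isoʳ    = λ X _ → SemiHeytingAlgebra.refl (H X)
    }

  -- Both sides have the same image under `embedding`: the classes of `f` applied to the two
  -- components of `x`.
  retraction-natural :
    {A B : SemiNelsonAlgebra ℓ ℓ} (f : SemiNelsonHomomorphism A B) →
    let open SemiNelsonHomomorphism f in
    ∀ x → SemiNelsonAlgebra._≈_ B
            (representative B (SemiNelsonHomomorphism.⟦_⟧ (α₁ (β₁ f)) x))
            ⟦ representative A x ⟧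
  retraction-natural {A} {B} f x = ≋-∼-≋⇒≈ B
    (trans (representative≋fst B (⟦αβf⟧ x)) (sym (cong (representative≋fst A x))))
    (trans (∼representative≋snd B (⟦αβf⟧ x))
      (sym (trans (≈⇒≋ B (SemiNelsonAlgebra.sym B (∼-homo _)))
                  (cong (∼representative≋snd A x)))))
    where
    open SemiNelsonHomomorphism f using (∼-homo)
    open FilterHomomorphism (β₁ f) using (cong)
    open SemiHeytingAlgebra (sH B) using (sym; trans)
    open SemiNelsonHomomorphism (α₁ (β₁ f)) using () renaming (⟦_⟧ to ⟦αβf⟧)

  αβ≅id : NaturalIsomorphism (α ℓ ℓ ℓ ∘F β ℓ ℓ) idF
  αβ≅id = record
    { η       = retraction
    ; η⁻¹     = embedding
    ; natural = retraction-natural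
    ; isoˡ    = λ A x → representative≋fst A x , ∼representative≋snd A x
    ; isoʳ    = λ A x → ≋-∼-≋⇒≈ A
                    (representative≋fst A (⟦ embedding A ⟧ x))
                    (∼representative≋snd A (⟦ embedding A ⟧ x))
    }
    where open SemiNelsonHomomorphism using (⟦_⟧)

theorem3p13 : ∀ (ℓ : Level) →
    NaturalIsomorphism (β ℓ ℓ ∘F α ℓ ℓ ℓ) idF ×
    NaturalIsomorphism (α ℓ ℓ ℓ ∘F β ℓ ℓ) idF
theorem3p13 ℓ = βα≅id , αβ≅id
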